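{- Let $R$ be a finite commutative reduced ring with non-zero identity, let $M_1,\dots,M_n$ be its (pairwise distinct) minimal prime ideals, so that $n$ is the number of minimal prime ideals of $R$. Let $\Gamma(R)$ be the zero divisor graph of $R$. If $n=1$, then $\mathrm{box}(\Gamma(R))=\dim_{TH}(\Gamma(R))=0$. If $n=2$, then \[\mathrm{box}(\Gamma(R))=\dim_{TH}(\Gamma(R))=\begin{cases}0 & \text{if both minimal prime ideals are lonely,}\\ 1 & \text{if exactly one minimal prime ideal is lonely,}\\ 2 & \text{if neither is lonely.}\end{cases}\] If $n\ge 3$, then \[\mathrm{box}(\Gamma(R))=\dim_{TH}(\Gamma(R))=\begin{cases}n-1 & \text{if there exists } i\in\{1,\dots,n\} \text{ such that } M_i \text{ is lonely,}\\ n & \text{otherwise.}\end{cases}\]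
   Context: All graphs are finite and simple. The boxicity $\mathrm{box}(G)$ of a graph $G$ is the minimum integer $d\ge 0$ such that there exist $d$ interval graphs $I_1,\dots,I_d$ on the vertex set $V(G)$ with $E(G)=\bigcap_{j=1}^d E(I_j)$ (equivalently, $G$ is the intersection graph of a family of axis-parallel boxes in $\mathbb{R}^d$). For a finite set $V$, $\alpha\colon V\to\mathbb{R}$ and $S\in\mathbb{R}$, the threshold graph $T(\alpha,S)$ has vertex set $V$ and edges all $\{v,w\}$, $v\neq w$, with $\alpha(v)+\alpha(w)\ge S$; a graph is a threshold graph if it is of this form. The threshold dimension $\dim_{TH}(G)$ is the minimum $d\ge 0$ such that there exist $d$ threshold graphs $H_1,\dots,H_d$ on $V(G)$ with $E(G)=\bigcap_{j=1}^d E(H_j)$. In both definitions the empty intersection ($d=0$) is the set of all pairs of vertices, so the parameter is $0$ exactly for complete graphs (including the graph with no vertices). A ring is reduced if $0$ is its only nilpotent element. $Z(R)$ is the set of $r\in R$ for which there is $s\in R\setminus\{0\}$ with $rs=0$. The zero divisor graph $\Gamma(R)$ has vertex set $Z(R)\setminus\{0\}$; two distinct vertices $r,s$ are adjacent iff $rs=0$. The minimal prime ideal $M_j$ is called lonely if the set $\left(\bigcap_{i\in\{1,\dots,n\}, i\ne j} M_i\right)\setminus M_j$ has exactly one element. -}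

module Defs where

open import Algebra.Bundles using (CommutativeRing)
open import Data.Fin.Base using (Fin)
open import Data.Nat.Base as ℕ using (ℕ)
import Data.Nat.Properties as ℕ
open import Data.Product.Base using (Σ; ∃; _×_; _,_; proj₁; proj₂)
open import Data.Rational.Base as ℚ using (ℚ; 0ℚ; ½; ∣_∣)
import Data.Rational.Properties as ℚ
open import Data.Rational.Solver using (module +-*-Solver)
open import Data.Sum.Base using (_⊎_)
open import Function.Bundles using (Func; Inverse; _⇔_)
open import Level using (Level; 0ℓ; suc; _⊔_)
open import Relation.Binary.Bundles using (Setoid)
open import Relation.Binary.Core using (Rel)
open import Relation.Binary.Definitions
  using (Irreflexive; Symmetric; _Respects₂_)
import Relation.Binary.Construct.On as On
open import Relation.Binary.PropositionalEquality using (_≡_; sym; trans; cong; subst)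
import Relation.Binary.PropositionalEquality.Properties as ≡
open import Relation.Nullary.Negation.Core using (¬_)
open import Relation.Unary using (Pred; _∈_; _∉_; _⊆_; _≐_)

private
  variable
    a b c ℓ p : Level

------------------------------------------------------------------------
-- Real numbers, as Cauchy sequences of rationals

-- An arbitrary Cauchy sequence, with no prescribed rate of convergence.

IsCauchy : (ℕ → ℚ) → Set
IsCauchy x = ∀ ε → 0ℚ ℚ.< ε →
  ∃ λ N → ∀ m n → N ℕ.≤ m → N ℕ.≤ n → ∣ x m ℚ.- x n ∣ ℚ.≤ ε

record ℝ : Set where
  field
    seq    : ℕ → ℚ
    cauchy : IsCauchy seq

open ℝ

infix 4 _≤ᴿ_ _≈ᴿ_

_≤ᴿ_ : Rel ℝ 0ℓ
x ≤ᴿ y = ∀ ε → 0ℚ ℚ.< ε →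
  ∃ λ N → ∀ n → N ℕ.≤ n → seq x n ℚ.≤ seq y n ℚ.+ ε

_≈ᴿ_ : Rel ℝ 0ℓ
x ≈ᴿ y = x ≤ᴿ y × y ≤ᴿ x

private
  ½-pos : ∀ ε → 0ℚ ℚ.< ε → 0ℚ ℚ.< ½ ℚ.* ε
  ½-pos ε 0<ε = subst (ℚ._< ½ ℚ.* ε) (ℚ.*-zeroʳ ½) (ℚ.*-monoʳ-<-pos ½ 0<ε)

  ½+½ : ∀ ε → ½ ℚ.* ε ℚ.+ ½ ℚ.* ε ≡ ε
  ½+½ ε = trans (sym (ℚ.*-distribʳ-+ ε ½ ½)) (ℚ.*-identityˡ ε)

  +-interchange : ∀ p q r s →
    (p ℚ.+ q) ℚ.+ (r ℚ.+ s) ≡ (p ℚ.+ r) ℚ.+ (q ℚ.+ s)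
  +-interchange = solve 4 (λ p q r s →
    (p :+ q) :+ (r :+ s) := (p :+ r) :+ (q :+ s)) _≡_.refl
    where open +-*-Solver

  +-−-interchange : ∀ p q r s →
    (p ℚ.+ q) ℚ.- (r ℚ.+ s) ≡ (p ℚ.- r) ℚ.+ (q ℚ.- s)
  +-−-interchange = solve 4 (λ p q r s →
    (p :+ q) :- (r :+ s) := (p :- r) :+ (q :- s)) _≡_.refl
    where open +-*-Solver

infixl 6 _+ᴿ_

_+ᴿ_ : ℝ → ℝ → ℝ
seq (x +ᴿ y) n = seq x n ℚ.+ seq y n
cauchy (x +ᴿ y) ε 0<ε = M ℕ.⊔ N , λ m n M⊔N≤m M⊔N≤n → begin
  ∣ (seq x m ℚ.+ seq y m) ℚ.- (seq x n ℚ.+ seq y n) ∣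
    ≡⟨ cong ∣_∣ (+-−-interchange (seq x m) (seq y m) (seq x n) (seq y n)) ⟩
  ∣ (seq x m ℚ.- seq x n) ℚ.+ (seq y m ℚ.- seq y n) ∣
    ≤⟨ ℚ.∣p+q∣≤∣p∣+∣q∣ (seq x m ℚ.- seq x n) (seq y m ℚ.- seq y n) ⟩
  ∣ seq x m ℚ.- seq x n ∣ ℚ.+ ∣ seq y m ℚ.- seq y n ∣
    ≤⟨ ℚ.+-mono-≤
         (proj₂ x-conv m n (ℕ.m⊔n≤o⇒m≤o M N M⊔N≤m) (ℕ.m⊔n≤o⇒m≤o M N M⊔N≤n))
         (proj₂ y-conv m n (ℕ.m⊔n≤o⇒n≤o M N M⊔N≤m) (ℕ.m⊔n≤o⇒n≤o M N M⊔N≤n)) ⟩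
  ½ ℚ.* ε ℚ.+ ½ ℚ.* ε
    ≡⟨ ½+½ ε ⟩
  ε ∎
  where
  open ℚ.≤-Reasoning
  x-conv = cauchy x (½ ℚ.* ε) (½-pos ε 0<ε)
  y-conv = cauchy y (½ ℚ.* ε) (½-pos ε 0<ε)
  M = proj₁ x-conv
  N = proj₁ y-conv

≤ᴿ-refl : ∀ x → x ≤ᴿ x
≤ᴿ-refl x ε 0<ε = 0 , λ n _ →
  subst (ℚ._≤ seq x n ℚ.+ ε) (ℚ.+-identityʳ (seq x n))
    (ℚ.+-monoʳ-≤ (seq x n) (ℚ.<⇒≤ 0<ε))

≤ᴿ-trans : ∀ x y z → x ≤ᴿ y → y ≤ᴿ z → x ≤ᴿ z
≤ᴿ-trans x y z x≤y y≤z ε 0<ε = M ℕ.⊔ N , λ n M⊔N≤n → begin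
  seq x n
    ≤⟨ proj₂ x≤y′ n (ℕ.m⊔n≤o⇒m≤o M N M⊔N≤n) ⟩
  seq y n ℚ.+ ½ ℚ.* ε
    ≤⟨ ℚ.+-monoˡ-≤ (½ ℚ.* ε) (proj₂ y≤z′ n (ℕ.m⊔n≤o⇒n≤o M N M⊔N≤n)) ⟩
  (seq z n ℚ.+ ½ ℚ.* ε) ℚ.+ ½ ℚ.* ε
    ≡⟨ ℚ.+-assoc (seq z n) (½ ℚ.* ε) (½ ℚ.* ε) ⟩
  seq z n ℚ.+ (½ ℚ.* ε ℚ.+ ½ ℚ.* ε)
    ≡⟨ cong (seq z n ℚ.+_) (½+½ ε) ⟩
  seq z n ℚ.+ ε ∎
  where
  open ℚ.≤-Reasoning
  x≤y′ = x≤y (½ ℚ.* ε) (½-pos ε 0<ε)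
  y≤z′ = y≤z (½ ℚ.* ε) (½-pos ε 0<ε)
  M = proj₁ x≤y′
  N = proj₁ y≤z′

+ᴿ-mono-≤ᴿ : ∀ w x y z → w ≤ᴿ x → y ≤ᴿ z → w +ᴿ y ≤ᴿ x +ᴿ z
+ᴿ-mono-≤ᴿ w x y z w≤x y≤z ε 0<ε = M ℕ.⊔ N , λ n M⊔N≤n → begin
  seq w n ℚ.+ seq y n
    ≤⟨ ℚ.+-mono-≤ (proj₂ w≤x′ n (ℕ.m⊔n≤o⇒m≤o M N M⊔N≤n))
                  (proj₂ y≤z′ n (ℕ.m⊔n≤o⇒n≤o M N M⊔N≤n)) ⟩
  (seq x n ℚ.+ ½ ℚ.* ε) ℚ.+ (seq z n ℚ.+ ½ ℚ.* ε)
    ≡⟨ +-interchange (seq x n) (½ ℚ.* ε) (seq z n) (½ ℚ.* ε) ⟩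
  (seq x n ℚ.+ seq z n) ℚ.+ (½ ℚ.* ε ℚ.+ ½ ℚ.* ε)
    ≡⟨ cong ((seq x n ℚ.+ seq z n) ℚ.+_) (½+½ ε) ⟩
  (seq x n ℚ.+ seq z n) ℚ.+ ε ∎
  where
  open ℚ.≤-Reasoning
  w≤x′ = w≤x (½ ℚ.* ε) (½-pos ε 0<ε)
  y≤z′ = y≤z (½ ℚ.* ε) (½-pos ε 0<ε)
  M = proj₁ w≤x′
  N = proj₁ y≤z′

ℝ-setoid : Setoid 0ℓ 0ℓ
ℝ-setoid = record
  { Carrier       = ℝ
  ; _≈_           = _≈ᴿ_
  ; isEquivalence = record
    { refl  = λ {x} → ≤ᴿ-refl x , ≤ᴿ-refl x
    ; sym   = λ (x≤y , y≤x) → y≤x , x≤y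
    ; trans = λ {x} {y} {z} (x≤y , y≤x) (y≤z , z≤y) →
        ≤ᴿ-trans x y z x≤y y≤z , ≤ᴿ-trans z y x z≤y y≤x
    }
  }

------------------------------------------------------------------------
-- Closed intervals [lower , upper] of the real line

record Interval : Set where
  field
    lower upper : ℝ
    lower≤upper : lower ≤ᴿ upper

open Interval

infix 4 _∈ᴵ_

_∈ᴵ_ : ℝ → Interval → Set
x ∈ᴵ I = lower I ≤ᴿ x × x ≤ᴿ upper I

Intersect : Rel Interval 0ℓ
Intersect I J = ∃ λ x → x ∈ᴵ I × x ∈ᴵ J

Interval-setoid : Setoid 0ℓ 0ℓ
Interval-setoid = record
  { Carrier       = Interval
  ; _≈_           = λ I J → lower I ≈ lower J × upper I ≈ upper J
  ; isEquivalence = record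
    { refl  = λ {I} → refl {lower I} , refl {upper I}
    ; sym   = λ {I} {J} (l , u) →
        symm {lower I} {lower J} l , symm {upper I} {upper J} u
    ; trans = λ {I} {J} {K} (l , u) (l′ , u′) →
        transi {lower I} {lower J} {lower K} l l′ ,
        transi {upper I} {upper J} {upper K} u u′
    }
  }
  where open Setoid ℝ-setoid using (_≈_; refl) renaming (sym to symm; trans to transi)

∈ᴵ-resp : ∀ x I J → Setoid._≈_ Interval-setoid I J → x ∈ᴵ I → x ∈ᴵ J
∈ᴵ-resp x I J ((_ , lJ≤lI) , (uI≤uJ , _)) (lI≤x , x≤uI) =
  ≤ᴿ-trans (lower J) (lower I) x lJ≤lI lI≤x ,
  ≤ᴿ-trans x (upper I) (upper J) x≤uI uI≤uJ

------------------------------------------------------------------------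
-- Simple graphs on a given set of vertices

record Graph (V : Setoid a b) : Set (a ⊔ suc b) where
  open Setoid V using (Carrier; _≈_)
  field
    Adj    : Rel Carrier b
    resp   : Adj Respects₂ _≈_
    symm   : Symmetric Adj
    irrefl : Irreflexive _≈_ Adj

module _ {V : Setoid a b} where

  open Setoid V using (_≈_) renaming (Carrier to Vertex; sym to ≈-sym; trans to ≈-trans)
  open Graph

  infix 4 _≈ᴳ_

  _≈ᴳ_ : Rel (Graph V) (a ⊔ b)
  G ≈ᴳ H = ∀ v w → Adj G v w ⇔ Adj H v w

  intervalGraph : Func V Interval-setoid → Graph V
  intervalGraph f = record
    { Adj    = λ v w → ¬ (v ≈ w) × Intersect (to v) (to w)
    ; resp   =
        (λ {u} {v} {w} v≈w (u≉v , x , x∈u , x∈v) →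
          (λ u≈w → u≉v (≈-trans u≈w (≈-sym v≈w))) ,
          x , x∈u , ∈ᴵ-resp x (to v) (to w) (to-cong v≈w) x∈v) ,
        (λ {u} {v} {w} v≈w (v≉u , x , x∈v , x∈u) →
          (λ w≈u → v≉u (≈-trans v≈w w≈u)) ,
          x , ∈ᴵ-resp x (to v) (to w) (to-cong v≈w) x∈v , x∈u)
    ; symm   = λ (v≉w , x , x∈v , x∈w) →
        (λ w≈v → v≉w (≈-sym w≈v)) , x , x∈w , x∈v
    ; irrefl = λ v≈w (v≉w , _) → v≉w v≈w
    }
    where open Func f using (to) renaming (cong to to-cong)

  IsIntervalGraph : Pred (Graph V) (a ⊔ b)
  IsIntervalGraph G = ∃ λ f → G ≈ᴳ intervalGraph f

  -- The graph T(α, S).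
  thresholdGraph : Func V ℝ-setoid → ℝ → Graph V
  thresholdGraph α S = record
    { Adj    = λ v w → ¬ (v ≈ w) × S ≤ᴿ to v +ᴿ to w
    ; resp   =
        (λ {u} {v} {w} v≈w (u≉v , S≤u+v) →
          (λ u≈w → u≉v (≈-trans u≈w (≈-sym v≈w))) ,
          ≤ᴿ-trans S (to u +ᴿ to v) (to u +ᴿ to w) S≤u+v
            (+ᴿ-mono-≤ᴿ (to u) (to u) (to v) (to w)
              (≤ᴿ-refl (to u)) (proj₁ (to-cong v≈w)))) ,
        (λ {u} {v} {w} v≈w (v≉u , S≤v+u) →
          (λ w≈u → v≉u (≈-trans v≈w w≈u)) ,
          ≤ᴿ-trans S (to v +ᴿ to u) (to w +ᴿ to u) S≤v+u
            (+ᴿ-mono-≤ᴿ (to v) (to w) (to u) (to u)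
              (proj₁ (to-cong v≈w)) (≤ᴿ-refl (to u))))
    ; symm   = λ {v} {w} (v≉w , S≤v+w) →
        (λ w≈v → v≉w (≈-sym w≈v)) ,
        ≤ᴿ-trans S (to v +ᴿ to w) (to w +ᴿ to v) S≤v+w (+ᴿ-comm-≤ (to v) (to w))
    ; irrefl = λ v≈w (v≉w , _) → v≉w v≈w
    }
    where
    open Func α using (to) renaming (cong to to-cong)

    +ᴿ-comm-≤ : ∀ x y → x +ᴿ y ≤ᴿ y +ᴿ x
    +ᴿ-comm-≤ x y ε 0<ε = 0 , λ n _ →
      subst (ℚ._≤ (seq y n ℚ.+ seq x n) ℚ.+ ε) (ℚ.+-comm (seq y n) (seq x n))
        (proj₂ (≤ᴿ-refl (y +ᴿ x) ε 0<ε) n ℕ.z≤n)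

  IsThresholdGraph : Pred (Graph V) (a ⊔ b)
  IsThresholdGraph G = ∃ λ α → ∃ λ S → G ≈ᴳ thresholdGraph α S

  -- Restricting to distinct v and w matters only for d = 0, where the
  -- intersection consists of all pairs of distinct vertices.
  IsIntersectionOf : Graph V → ∀ {d} → (Fin d → Graph V) → Set (a ⊔ b)
  IsIntersectionOf G H =
    ∀ v w → ¬ (v ≈ w) → Adj G v w ⇔ (∀ j → Adj (H j) v w)

  IsIntersectionOfSome : Pred (Graph V) p → Graph V → ℕ → Set (a ⊔ suc b ⊔ p)
  IsIntersectionOfSome P G d =
    ∃ λ (H : Fin d → Graph V) → (∀ j → P (H j)) × IsIntersectionOf G H

  IsMinimum : Pred ℕ p → Pred ℕ p
  IsMinimum Q d = Q d × (∀ d′ → Q d′ → d ℕ.≤ d′)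

  -- IsBoxicity G d means box(G) = d.
  IsBoxicity : Graph V → ℕ → Set (a ⊔ suc b)
  IsBoxicity G = IsMinimum (IsIntersectionOfSome IsIntervalGraph G)

  -- IsThresholdDimension G d means dim_TH(G) = d.
  IsThresholdDimension : Graph V → ℕ → Set (a ⊔ suc b)
  IsThresholdDimension G = IsMinimum (IsIntersectionOfSome IsThresholdGraph G)

------------------------------------------------------------------------
-- Commutative rings

IsFinite : Setoid a b → Set (a ⊔ b)
IsFinite S = ∃ λ n → Inverse S (≡.setoid (Fin n))

module RingDefs (R : CommutativeRing c ℓ) where

  open CommutativeRing R hiding (sym)
  open import Algebra.Properties.Semiring.Exp semiring using (_^_)

  IsNilpotent : Pred Carrier ℓ
  IsNilpotent x = ∃ λ n → x ^ n ≈ 0#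

  IsReduced : Set (c ⊔ ℓ)
  IsReduced = ∀ x → IsNilpotent x → x ≈ 0#

  record IsIdeal (I : Pred Carrier p) : Set (c ⊔ ℓ ⊔ p) where
    field
      resp     : ∀ {x y} → x ≈ y → x ∈ I → y ∈ I
      0#-mem   : 0# ∈ I
      +-closed : ∀ {x y} → x ∈ I → y ∈ I → x + y ∈ I
      *-closed : ∀ r {x} → x ∈ I → r * x ∈ I

  record IsPrimeIdeal (P : Pred Carrier p) : Set (c ⊔ ℓ ⊔ p) where
    field
      isIdeal : IsIdeal P
      proper  : 1# ∉ P
      prime   : ∀ {x y} → x * y ∈ P → x ∈ P ⊎ y ∈ P

  record IsMinimalPrimeIdeal (P : Pred Carrier p) : Set (c ⊔ ℓ ⊔ suc p) where
    field
      isPrimeIdeal : IsPrimeIdeal P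
      minimal      : ∀ (Q : Pred Carrier p) → IsPrimeIdeal Q → Q ⊆ P → P ⊆ Q

  record AreTheMinimalPrimeIdeals {n : ℕ} (M : Fin n → Pred Carrier p) :
         Set (c ⊔ ℓ ⊔ suc p) where
    field
      isMinimalPrime : ∀ i → IsMinimalPrimeIdeal (M i)
      distinct       : ∀ i j → M i ≐ M j → i ≡ j
      exhaustive     : ∀ (P : Pred Carrier p) → IsMinimalPrimeIdeal P → ∃ λ i → P ≐ M i

  -- The elements of (⋂ᵢ≠ⱼ Mᵢ) ∖ Mⱼ.
  OnlyOutside : ∀ {n} → (Fin n → Pred Carrier p) → Fin n → Pred Carrier p
  OnlyOutside M j x = (∀ i → ¬ (i ≡ j) → x ∈ M i) × x ∉ M j

  Lonely : ∀ {n} → (Fin n → Pred Carrier p) → Fin n → Set (c ⊔ ℓ ⊔ p)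
  Lonely M j = ∃ λ x → OnlyOutside M j x × (∀ y → OnlyOutside M j y → x ≈ y)

  Z : Pred Carrier (c ⊔ ℓ)
  Z r = ∃ λ s → ¬ (s ≈ 0#) × r * s ≈ 0#

  Γ-vertices : Setoid (c ⊔ ℓ) ℓ
  Γ-vertices = On.setoid {B = Σ Carrier λ r → r ∈ Z × ¬ (r ≈ 0#)} setoid proj₁

  Γ : Graph Γ-vertices
  Γ = record
    { Adj    = λ (r , _) (s , _) → ¬ (r ≈ s) × r * s ≈ 0#
    ; resp   =
        (λ s≈t (r≉s , rs≈0) →
          (λ r≈t → r≉s (≈-trans r≈t (≈-sym s≈t))) ,
          ≈-trans (*-congˡ (≈-sym s≈t)) rs≈0) ,
        (λ s≈t (s≉r , sr≈0) →
          (λ t≈r → s≉r (≈-trans s≈t t≈r)) ,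
          ≈-trans (*-congʳ (≈-sym s≈t)) sr≈0)
    ; symm   = λ (r≉s , rs≈0) →
        (λ s≈r → r≉s (≈-sym s≈r)) , ≈-trans (*-comm _ _) rs≈0
    ; irrefl = λ r≈s (r≉s , _) → r≉s r≈s
    }
    where open Setoid setoid using () renaming (sym to ≈-sym; trans to ≈-trans)

{-# OPTIONS --safe #-}
module Submission where

-- The support of a vertex x is {i : x ∉ M i}.  As R is reduced, the minimal primes meet in 0, so
-- two vertices are adjacent iff their supports are disjoint.  Every nonempty proper set of
-- indices is a support, and {j} is the support of exactly one vertex iff M j is lonely.
--
-- Upper bounds: the i-th graph misses {v , w} iff i lies in both supports.  If M j is lonely, the
-- j-th graph can be dropped: distinct vertices whose supports meet only in j cannot both have
-- support {j}, so some i ≠ j lies in one of the supports, and the i-th graph can be modified so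
-- as to miss such pairs too.
--
-- Lower bounds: an interval or threshold graph containing the other four edges of a 4-set cannot
-- miss two disjoint pairs, so two vertices with support {i}, for the various nonlonely M i,
-- require pairwise different graphs.  A threshold graph cannot even miss two pairs {v , w} and
-- {v′ , w′} while containing {v , w′} and {v′ , w}; this separates the non-edges
-- ({i} , {i , 0}) for i ≠ 0.  Interval graphs may contain such paths, and there one counts the
-- n (n - 1) non-edges ({i} , {i , k}), viewed as arcs i → k.  If an interval graph puts {i} to the
-- left of {i , k}, then i = a, the index whose interval {a} ends first, except for at most one
-- arc b → a; symmetrically on the right.  A vertex {i , k} on one side and {j , l} on the other are
-- not adjacent, hence share an index.  So a single interval graph misses at most max (5 , n + 1)
-- arcs, and n (n - 1) ≤ d max (5 , n + 1) forces d ≥ n - 1.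

open import Defs
open import Algebra.Bundles using (CommutativeRing)
open import Data.Bool.Base using (Bool; true; false; not)
open import Data.Empty using (⊥)
open import Data.Fin.Base as Fin using (Fin; zero; suc; toℕ; punchIn; punchOut; combine; remQuot; inject≤)
import Data.Fin.Properties as Fin
open import Data.Fin.Properties using (_≟_; any?; all?)
open import Data.List.Base using (List; []; _∷_; length; map; allFin; lookup)
open import Data.List.Membership.Propositional using () renaming (_∈_ to _∈ᴸ_)
open import Data.List.Membership.Propositional.Properties using (∈-map⁺; ∈-allFin)
import Data.List.Properties as List
open import Data.List.Relation.Unary.Any using (here; there; index)
open import Data.List.Relation.Unary.Any.Properties using (lookup-index)
open import Data.Nat.Base as ℕ using (ℕ; zero; suc; _∸_; _≤_; z≤n; s≤s)
import Data.Nat.Properties as ℕ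
import Data.Nat.Solver as ℕ-Solver
open import Data.Product using (∃; ∃₂; ∃!; _×_; _,_; proj₁; proj₂; uncurry)
open import Data.Rational.Base as ℚ using (ℚ; 0ℚ; 1ℚ; ½)
import Data.Rational.Properties as ℚ
import Data.Rational.Solver as ℚ-Solver
open import Data.Sum.Base as Sum using (_⊎_; inj₁; inj₂; [_,_]; [_,_]′)
open import Function.Base using (_∘_; id)
open import Function.Bundles using (Func; Inverse; Equivalence; _⇔_; mk⇔)
open import Level using (Level; Lift; lift; _⊔_)
open import Relation.Binary.Bundles using (Setoid)
open import Relation.Binary.PropositionalEquality as ≡ using (_≡_; _≢_; refl; cong; cong₂; subst; subst₂)
open import Relation.Nullary using (¬_; Dec; yes; no; does; contradiction; ¬?; _×-dec_; _⊎-dec_; _→-dec_)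
open import Relation.Nullary.Decidable using (True; toWitness; fromWitness; map′; decidable-stable; toSum; dec-true; dec-false; does-⇔; ¬¬-excluded-middle)
open import Relation.Unary using (Pred; _∈_; _∉_; _⊆_)
open ℝ
open Interval
open Equivalence using () renaming (to to ⇒; from to ⇐)

private variable
  ℓ₁ ℓ₂ p q : Level
  n m d : ℕ

-- Real numbers

module _ where
  open import Data.Rational.Base using (_+_; _-_)

  ½-positive : ∀ {ε} → 0ℚ ℚ.< ε → 0ℚ ℚ.< ½ ℚ.* ε
  ½-positive {ε} 0<ε = subst (ℚ._< ½ ℚ.* ε) (ℚ.*-zeroʳ ½) (ℚ.*-monoʳ-<-pos ½ 0<ε)

  ½+½≡ : ∀ ε → ½ ℚ.* ε + ½ ℚ.* ε ≡ ε
  ½+½≡ ε = ≡.trans (≡.sym (ℚ.*-distribʳ-+ ε ½ ½)) (ℚ.*-identityˡ ε)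

  p≤∣p∣ : ∀ p → p ℚ.≤ ℚ.∣ p ∣
  p≤∣p∣ p with ℚ.≤-total 0ℚ p
  ... | inj₁ 0≤p = ℚ.≤-reflexive (≡.sym (ℚ.0≤p⇒∣p∣≡p 0≤p))
  ... | inj₂ p≤0 = ℚ.≤-trans p≤0 (ℚ.0≤∣p∣ p)

  ∣p-q∣≤⇒p≤q+ : ∀ p q {δ} → ℚ.∣ p - q ∣ ℚ.≤ δ → p ℚ.≤ q + δ
  ∣p-q∣≤⇒p≤q+ p q {δ} le = begin
    p            ≡⟨ solve 2 (λ p q → p := q :+ (p :- q)) refl p q ⟩
    q + (p - q)  ≤⟨ ℚ.+-monoʳ-≤ q (ℚ.≤-trans (p≤∣p∣ (p - q)) le) ⟩
    q + δ        ∎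
    where
    open ℚ.≤-Reasoning
    open ℚ-Solver.+-*-Solver

  +-cancelˡ-≤ : ∀ r {p q} → r + p ℚ.≤ r + q → p ℚ.≤ q
  +-cancelˡ-≤ r {p} {q} le = subst₂ ℚ._≤_ (cancel r p) (cancel r q) (ℚ.+-monoʳ-≤ (ℚ.- r) le)
    where
    open ℚ-Solver.+-*-Solver
    cancel : ∀ r p → ℚ.- r + (r + p) ≡ p
    cancel = solve 2 (λ r p → :- r :+ (r :+ p) := p) refl

  -- Reals cannot be compared effectively, so rational terms are compared at one index `N` past
  -- which both sequences stay within `δ`. Either outcome persists for all later `n`, and the second
  -- contradicts the hypothesis.
  ≰ᴿ⇒≥ᴿ : ∀ {x y} → ¬ (x ≤ᴿ y) → y ≤ᴿ x
  ≰ᴿ⇒≥ᴿ {x} {y} x≰y ε 0<ε = N , ordered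
    where
    open ℚ.≤-Reasoning
    open ℚ-Solver.+-*-Solver
    η δ : ℚ
    η = ½ ℚ.* ε
    -- A quarter of `ε`: in the first case two Cauchy errors, `η` and nothing else make up `ε`; in
    -- the second the two errors use up exactly the gap `η`.
    δ = ½ ℚ.* η
    x-conv = cauchy x δ (½-positive (½-positive 0<ε))
    y-conv = cauchy y δ (½-positive (½-positive 0<ε))
    N = proj₁ x-conv ℕ.⊔ proj₁ y-conv
    N₁≤N = ℕ.m≤m⊔n (proj₁ x-conv) (proj₁ y-conv)
    N₂≤N = ℕ.m≤n⊔m (proj₁ x-conv) (proj₁ y-conv)

    near : ∀ z (z-conv : ∃ λ M → ∀ m n → M ≤ m → M ≤ n → ℚ.∣ seq z m - seq z n ∣ ℚ.≤ δ) →
      proj₁ z-conv ≤ N → ∀ n → N ≤ n → seq z n ℚ.≤ seq z N + δ × seq z N ℚ.≤ seq z n + δ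
    near z (M , conv) M≤N n N≤n =
      ∣p-q∣≤⇒p≤q+ _ _ (conv n N (ℕ.≤-trans M≤N N≤n) M≤N) ,
      ∣p-q∣≤⇒p≤q+ _ _ (conv N n M≤N (ℕ.≤-trans M≤N N≤n))

    ordered : ∀ n → N ≤ n → seq y n ℚ.≤ seq x n + ε
    ordered with seq y N - η ℚ.≤? seq x N
    ... | yes close = λ n N≤n → begin
      seq y n                    ≤⟨ proj₁ (near y y-conv N₂≤N n N≤n) ⟩
      seq y N + δ                ≡⟨ solve 3 (λ p e d → p :+ d := (p :- e) :+ (e :+ d)) refl (seq y N) η δ ⟩
      (seq y N - η) + (η + δ)    ≤⟨ ℚ.+-monoˡ-≤ (η + δ) (ℚ.≤-trans close (proj₂ (near x x-conv N₁≤N n N≤n))) ⟩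
      (seq x n + δ) + (η + δ)    ≡⟨ solve 3 (λ p e d → (p :+ d) :+ (e :+ d) := p :+ (e :+ (d :+ d))) refl (seq x n) η δ ⟩
      seq x n + (η + (δ + δ))    ≡⟨ cong (λ t → seq x n + (η + t)) (½+½≡ η) ⟩
      seq x n + (η + η)          ≡⟨ cong (seq x n +_) (½+½≡ ε) ⟩
      seq x n + ε                ∎
    ... | no far = contradiction x≤y x≰y
      where
      x≤y : x ≤ᴿ y
      x≤y ε′ 0<ε′ = N , λ n N≤n → begin
        seq x n                    ≤⟨ proj₁ (near x x-conv N₁≤N n N≤n) ⟩
        seq x N + δ                ≤⟨ ℚ.+-monoˡ-≤ δ (ℚ.<⇒≤ (ℚ.≰⇒> far)) ⟩
        (seq y N - η) + δ          ≤⟨ ℚ.+-monoˡ-≤ δ (ℚ.+-monoˡ-≤ (ℚ.- η) (proj₂ (near y y-conv N₂≤N n N≤n))) ⟩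
        ((seq y n + δ) - η) + δ    ≡⟨ solve 3 (λ p e d → ((p :+ d) :- e) :+ d := p :+ ((d :+ d) :- e)) refl (seq y n) η δ ⟩
        seq y n + ((δ + δ) - η)    ≡⟨ cong (λ t → seq y n + (t - η)) (½+½≡ η) ⟩
        seq y n + (η - η)          ≡⟨ cong (seq y n +_) (ℚ.+-inverseʳ η) ⟩
        seq y n + 0ℚ               ≤⟨ ℚ.+-monoʳ-≤ (seq y n) (ℚ.<⇒≤ 0<ε′) ⟩
        seq y n + ε′               ∎

  pointwise⇒≤ᴿ : ∀ x y → (∀ n → seq x n ≡ seq y n) → x ≤ᴿ y
  pointwise⇒≤ᴿ x y eq ε 0<ε = 0 , λ n _ →
    subst (λ p → p ℚ.≤ seq y n + ε) (≡.sym (eq n)) (proj₂ (≤ᴿ-refl y ε 0<ε) n z≤n)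

  +ᴿ-cancelˡ-≤ᴿ : ∀ x y z → x +ᴿ y ≤ᴿ x +ᴿ z → y ≤ᴿ z
  +ᴿ-cancelˡ-≤ᴿ x y z le ε 0<ε = proj₁ (le ε 0<ε) , λ n N≤n →
    +-cancelˡ-≤ (seq x n) (subst (seq x n + seq y n ℚ.≤_) (ℚ.+-assoc (seq x n) (seq z n) ε)
      (proj₂ (le ε 0<ε) n N≤n))

  -- s + s ≤ (x + w) + (z + y) = (x + y) + (z + w) ≤ s + (z + w), and s cancels.
  ≤ᴿ-exchange : ∀ s w x y z → s ≤ᴿ x +ᴿ w → s ≤ᴿ z +ᴿ y → x +ᴿ y ≤ᴿ s → s ≤ᴿ z +ᴿ w
  ≤ᴿ-exchange s w x y z s≤x+w s≤z+y x+y≤s = +ᴿ-cancelˡ-≤ᴿ s s (z +ᴿ w)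
    (≤ᴿ-trans (s +ᴿ s) ((x +ᴿ w) +ᴿ (z +ᴿ y)) (s +ᴿ (z +ᴿ w))
      (+ᴿ-mono-≤ᴿ s (x +ᴿ w) s (z +ᴿ y) s≤x+w s≤z+y)
      (≤ᴿ-trans ((x +ᴿ w) +ᴿ (z +ᴿ y)) ((x +ᴿ y) +ᴿ (z +ᴿ w)) (s +ᴿ (z +ᴿ w))
        (pointwise⇒≤ᴿ ((x +ᴿ w) +ᴿ (z +ᴿ y)) ((x +ᴿ y) +ᴿ (z +ᴿ w))
          (λ n → rearrange (seq x n) (seq w n) (seq z n) (seq y n)))
        (+ᴿ-mono-≤ᴿ (x +ᴿ y) s (z +ᴿ w) (z +ᴿ w) x+y≤s (≤ᴿ-refl (z +ᴿ w)))))
    where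
    open ℚ-Solver.+-*-Solver
    rearrange : ∀ x w z y → (x + w) + (z + y) ≡ (x + y) + (z + w)
    rearrange = solve 4 (λ x w z y → (x :+ w) :+ (z :+ y) := (x :+ y) :+ (z :+ w)) refl

  ℕ→ℚ : ℕ → ℚ
  ℕ→ℚ zero    = 0ℚ
  ℕ→ℚ (suc k) = 1ℚ + ℕ→ℚ k

  ℕ→ℚ-homo-+ : ∀ m n → ℕ→ℚ (m ℕ.+ n) ≡ ℕ→ℚ m + ℕ→ℚ n
  ℕ→ℚ-homo-+ zero    n = ≡.sym (ℚ.+-identityˡ (ℕ→ℚ n))
  ℕ→ℚ-homo-+ (suc m) n = ≡.trans (cong (1ℚ +_) (ℕ→ℚ-homo-+ m n)) (≡.sym (ℚ.+-assoc 1ℚ (ℕ→ℚ m) (ℕ→ℚ n)))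

  ℕ→ℚ-mono-≤ : ∀ {m n} → m ≤ n → ℕ→ℚ m ℚ.≤ ℕ→ℚ n
  ℕ→ℚ-mono-≤ {n = zero}  z≤n       = ℚ.≤-refl
  ℕ→ℚ-mono-≤ {n = suc n} z≤n       =
    ℚ.+-mono-≤ (ℚ.<⇒≤ (ℚ.positive⁻¹ 1ℚ)) (ℕ→ℚ-mono-≤ {zero} {n} z≤n)
  ℕ→ℚ-mono-≤             (s≤s m≤n) = ℚ.+-monoʳ-≤ 1ℚ (ℕ→ℚ-mono-≤ m≤n)

  fromℕ : ℕ → ℝ
  seq (fromℕ k) _ = ℕ→ℚ k
  cauchy (fromℕ k) ε 0<ε = 0 , λ _ _ _ _ →
    subst (λ p → ℚ.∣ p ∣ ℚ.≤ ε) (≡.sym (ℚ.+-inverseʳ (ℕ→ℚ k))) (ℚ.<⇒≤ 0<ε)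

  fromℕ-mono-≤ : ∀ {m n} → m ≤ n → fromℕ m ≤ᴿ fromℕ n
  fromℕ-mono-≤ {m} {n} m≤n ε 0<ε = 0 , λ k _ →
    ℚ.≤-trans (ℕ→ℚ-mono-≤ m≤n) (proj₂ (≤ᴿ-refl (fromℕ n) ε 0<ε) k z≤n)

  fromℕ-cancel-≤ : ∀ {m n} → fromℕ m ≤ᴿ fromℕ n → m ≤ n
  fromℕ-cancel-≤ {m} {n} le with m ℕ.≤? n
  ... | yes m≤n = m≤n
  ... | no m≰n = contradiction (ℚ.≤-<-trans 1+n≤n+½ n+½<1+n) (ℚ.<-irrefl refl)
    where
    -- The tolerance ½ is smaller than the gap between consecutive integers.
    0<½ = ℚ.positive⁻¹ ½
    1+n≤n+½ : ℕ→ℚ (suc n) ℚ.≤ ℕ→ℚ n + ½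
    1+n≤n+½ = ℚ.≤-trans (ℕ→ℚ-mono-≤ (ℕ.≰⇒> m≰n)) (proj₂ (le ½ 0<½) _ ℕ.≤-refl)
    n+½<1+n : ℕ→ℚ n + ½ ℚ.< ℕ→ℚ (suc n)
    n+½<1+n = subst (ℕ→ℚ n + ½ ℚ.<_) (ℚ.+-comm (ℕ→ℚ n) 1ℚ)
      (ℚ.+-monoʳ-< (ℕ→ℚ n) (subst (½ ℚ.<_) refl (ℚ.+-monoʳ-< ½ 0<½)))

  fromℕ-+ : ∀ m n → fromℕ m +ᴿ fromℕ n ≈ᴿ fromℕ (m ℕ.+ n)
  fromℕ-+ m n =
    pointwise⇒≤ᴿ (fromℕ m +ᴿ fromℕ n) (fromℕ (m ℕ.+ n)) (λ _ → ≡.sym (ℕ→ℚ-homo-+ m n)) ,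
    pointwise⇒≤ᴿ (fromℕ (m ℕ.+ n)) (fromℕ m +ᴿ fromℕ n) (λ _ → ℕ→ℚ-homo-+ m n)

-- Covering the arcs of a complete digraph by stars and triangles

-- Double negation shift over a finite index set. The final bounds are decidable statements about
-- naturals, so finitely many undecidable facts about reals may be assumed settled while proving
-- them.
Fin-¬¬-∀ : ∀ {P : Fin n → Set p} → (∀ i → ¬ ¬ P i) → ¬ ¬ (∀ i → P i)
Fin-¬¬-∀ {n = zero}  ¬¬P ¬∀P = ¬∀P λ ()
Fin-¬¬-∀ {n = suc n} ¬¬P ¬∀P = ¬¬P zero λ P₀ → Fin-¬¬-∀ (¬¬P ∘ suc) λ P₊ →
  ¬∀P λ { zero → P₀ ; (suc i) → P₊ i }

least : (_≼_ : Fin (suc n) → Fin (suc n) → Set p) →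
  (∀ i j k → i ≼ j → j ≼ k → i ≼ k) → (∀ i j → i ≼ j ⊎ j ≼ i) → ∃ λ i → ∀ j → i ≼ j
least {n = zero} _≼_ ≼-trans ≼-total = zero , λ { zero → [ id , id ] (≼-total zero zero) }
least {n = suc n} _≼_ ≼-trans ≼-total
  with i , i-least ← least (λ i j → suc i ≼ suc j)
    (λ i j k → ≼-trans (suc i) (suc j) (suc k)) (λ i j → ≼-total (suc i) (suc j))
  with ≼-total zero (suc i)
... | inj₁ 0≼i = zero , λ
  { zero    → [ id , id ] (≼-total zero zero)
  ; (suc j) → ≼-trans zero (suc i) (suc j) 0≼i (i-least j)
  }
... | inj₂ i≼0 = suc i , λ { zero → i≼0 ; (suc j) → i-least j }

third : 2 ≤ m → ∀ (i k : Fin (suc m)) → ∃ λ l → l ≢ i × l ≢ k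
third (s≤s (s≤s _)) i k with i ≟ k
... | yes refl = punchIn i zero , Fin.punchInᵢ≢i i zero , Fin.punchInᵢ≢i i zero
... | no i≢k = punchIn i (punchIn (punchOut i≢k) zero) , Fin.punchInᵢ≢i i _ , λ l≡k →
  Fin.punchInᵢ≢i (punchOut i≢k) zero
    (Fin.punchIn-injective i _ _ (≡.trans l≡k (≡.sym (Fin.punchIn-punchOut i≢k))))

Arc : ℕ → Set
Arc n = Fin n × Fin n

Apex : (Fin n → Fin n → Set p) → Fin n → Fin n → Set p
Apex A a b = ∀ {i k} → A i k → i ≡ a ⊎ i ≡ b × k ≡ a

-- By the last hypothesis an index off an arc lies strictly above the tail of the arc. So the least
-- index a is on every arc, and two arcs into a with different tails would put each tail strictly
-- above the other. If no arc enters a from elsewhere, b is set to a.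
apex : (A : Fin n → Fin n → Set p) → (∀ i k → Dec (A i k)) →
  (_≼_ : Fin n → Fin n → Set q) → (∀ i j → i ≼ j ⊎ j ≼ i) → (∃ λ a → ∀ j → a ≼ j) →
  (∀ {i k j} → A i k → j ≢ i → j ≢ k → ¬ (j ≼ i)) →
  ∃₂ λ a b → Apex A a b
apex A A? _≼_ ≼-total (a , a-least) below with any? (λ b → ¬? (b ≟ a) ×-dec A? b a)
... | no ∄b = a , a , inj₁ ∘ only-a
  where
  only-a : ∀ {i k} → A i k → i ≡ a
  only-a {i} {k} Aik with i ≟ a | k ≟ a
  ... | yes i≡a | _        = i≡a
  ... | no i≢a  | yes refl = contradiction (i , i≢a , Aik) ∄b
  ... | no i≢a  | no k≢a   = contradiction (a-least i) (below Aik (i≢a ∘ ≡.sym) (k≢a ∘ ≡.sym))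
... | yes (b , b≢a , Aba) = a , b , a-or-b
  where
  a-or-b : Apex A a b
  a-or-b {i} {k} Aik with i ≟ a | k ≟ a | i ≟ b
  ... | yes i≡a | _        | _       = inj₁ i≡a
  ... | no i≢a  | no k≢a   | _       = contradiction (a-least i) (below Aik (i≢a ∘ ≡.sym) (k≢a ∘ ≡.sym))
  ... | no i≢a  | yes k≡a  | yes i≡b = inj₂ (i≡b , k≡a)
  ... | no i≢a  | yes refl | no i≢b  = contradiction (≼-total b i)
    [ below Aik (i≢b ∘ ≡.sym) b≢a , below Aba i≢b i≢a ]

star : Fin (suc m) → List (Arc (suc m))
star a = map (λ k → a , punchIn a k) (allFin _)

length-star : (a : Fin (suc m)) → length (star a) ≡ m
length-star {m} a = ≡.trans (List.length-map (λ k → a , punchIn a k) (allFin m)) (List.length-tabulate {n = m} id)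

∈-star : ∀ {a k : Fin (suc m)} → a ≢ k → (a , k) ∈ᴸ star a
∈-star {a = a} a≢k = subst (λ k → (a , k) ∈ᴸ star a) (Fin.punchIn-punchOut a≢k)
  (∈-map⁺ (λ k → a , punchIn a k) (∈-allFin (punchOut a≢k)))

SharesEnd : Fin n → Fin n → Fin n → Fin n → Set
SharesEnd i k j l = i ≡ j ⊎ i ≡ l ⊎ k ≡ j ⊎ k ≡ l

Covers : (Fin n → Fin n → Set p) → List (Arc n) → Set p
Covers A C = ∀ {i k} → A i k → (i , k) ∈ᴸ C

-- The bound allows for both covers that occur: five arcs of a triangle, or a star of m arcs with
-- two further ones.
ShortCover : (Fin (suc m) → Fin (suc m) → Set p) → (Fin (suc m) → Fin (suc m) → Set p) → Set p
ShortCover {m} A B = ∃ λ C → length C ≤ 5 ℕ.⊔ (2 ℕ.+ m) × Covers A C × Covers B C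

starCover : ∀ {A B : Fin (suc m) → Fin (suc m) → Set p} →
  (∀ {i k} → A i k → i ≢ k) → (∀ {i k} → B i k → i ≢ k) → ∀ a u v →
  (∀ {i k} → A i k → i ≡ a ⊎ (i , k) ≡ u) → (∀ {i k} → B i k → i ≡ a ⊎ (i , k) ≡ v) →
  ShortCover A B
starCover {m = m} {A = A} {B} A-irrefl B-irrefl a u v A-star B-star =
  u ∷ v ∷ star a , ℕ.≤-trans (ℕ.≤-reflexive (cong (2 ℕ.+_) (length-star a))) (ℕ.m≤n⊔m 5 (2 ℕ.+ m)) ,
  (λ Aik → A⊆C Aik (A-star Aik)) , (λ Bik → B⊆C Bik (B-star Bik))
  where
  A⊆C : ∀ {i k} → A i k → i ≡ a ⊎ (i , k) ≡ u → (i , k) ∈ᴸ u ∷ v ∷ star a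
  A⊆C Aik (inj₁ refl) = there (there (∈-star (A-irrefl Aik)))
  A⊆C Aik (inj₂ ik≡u) = here ik≡u
  B⊆C : ∀ {i k} → B i k → i ≡ a ⊎ (i , k) ≡ v → (i , k) ∈ᴸ u ∷ v ∷ star a
  B⊆C Bik (inj₁ refl) = there (there (∈-star (B-irrefl Bik)))
  B⊆C Bik (inj₂ ik≡v) = there (here ik≡v)

swapCover : ∀ {A B : Fin (suc m) → Fin (suc m) → Set p} → ShortCover A B → ShortCover B A
swapCover (C , short , A-covered , B-covered) = C , short , B-covered , A-covered

module _ {A B : Fin (suc m) → Fin (suc m) → Set p}
  (A-irrefl : ∀ {i k} → A i k → i ≢ k) (B-irrefl : ∀ {i k} → B i k → i ≢ k)
  {a b a′ b′ : Fin (suc m)} (A-apex : Apex A a b) (B-apex : Apex B a′ b′) where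

  sameApexCover : a ≡ a′ → ShortCover A B
  sameApexCover refl = starCover A-irrefl B-irrefl a (b , a) (b′ , a)
    (Sum.map₂ (uncurry (cong₂ _,_)) ∘ A-apex) (Sum.map₂ (uncurry (cong₂ _,_)) ∘ B-apex)

  -- All arcs of A then run between a and a′. The arc a′ → a belongs to the star at a′, so only a →
  -- a′ and b′ → a′ have to be added to that star.
  lopsidedCover : ¬ (∃ λ k → k ≢ a′ × (A a k ⊎ A k a)) → ShortCover A B
  lopsidedCover ∄k = starCover A-irrefl B-irrefl a′ (a , a′) (b′ , a′) A-in
    (Sum.map₂ (uncurry (cong₂ _,_)) ∘ B-apex)
    where
    A-in : ∀ {i k} → A i k → i ≡ a′ ⊎ (i , k) ≡ (a , a′)
    A-in {i} {k} Aik with A-apex Aik | k ≟ a′ | i ≟ a′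
    ... | _                    | _        | yes i≡a′ = inj₁ i≡a′
    ... | inj₁ refl            | yes refl | _        = inj₂ refl
    ... | inj₁ refl            | no k≢a′  | _        = contradiction (k , k≢a′ , inj₁ Aik) ∄k
    ... | inj₂ (refl , refl)   | _        | no i≢a′  = contradiction (i , i≢a′ , inj₂ Aik) ∄k

-- A and B stand for the arcs i → k for which an interval graph puts the vertex {i} to the left,
-- respectively to the right, of the vertex {i , k}.  Unless all these arcs touch one index, they
-- lie in a triangle, and at most five of its six arcs occur.
shortCover : {A B : Fin (suc m) → Fin (suc m) → Set p} →
  (∀ i k → Dec (A i k)) → (∀ i k → Dec (B i k)) →
  (∀ {i k} → A i k → i ≢ k) → (∀ {i k} → B i k → i ≢ k) →
  (∀ {i k j l} → A i k → B j l → SharesEnd i k j l) →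
  (∀ {i k} → A i k → ¬ B i k) → (∀ {i k} → A i k → ¬ B k i) →
  ∀ {a b a′ b′} → Apex A a b → Apex B a′ b′ → ShortCover A B
shortCover {m = m} {A = A} {B} A? B? A-irrefl B-irrefl cross disjoint disjoint′ {a} {b} {a′} {b′} A-apex B-apex
  with a ≟ a′
     | any? (λ k → ¬? (k ≟ a′) ×-dec (A? a k ⊎-dec A? k a))
     | any? (λ k → ¬? (k ≟ a) ×-dec (B? a′ k ⊎-dec B? k a′))
... | yes a≡a′ | _     | _ = sameApexCover A-irrefl B-irrefl A-apex B-apex a≡a′
... | no _     | no ∄k | _ = lopsidedCover A-irrefl B-irrefl A-apex B-apex ∄k
... | no _     | yes _ | no ∄k = swapCover (lopsidedCover B-irrefl A-irrefl B-apex A-apex ∄k)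
... | no a≢a′  | yes (x , x≢a′ , Aax) | yes (y , y≢a , Ba′y) = triangle
  where
  flipʳ : ∀ {i k j l : Fin (suc m)} → SharesEnd i k j l → SharesEnd i k l j
  flipʳ (inj₁ i≡j)               = inj₂ (inj₁ i≡j)
  flipʳ (inj₂ (inj₁ i≡l))        = inj₁ i≡l
  flipʳ (inj₂ (inj₂ (inj₁ k≡j))) = inj₂ (inj₂ (inj₂ k≡j))
  flipʳ (inj₂ (inj₂ (inj₂ k≡l))) = inj₂ (inj₂ (inj₁ k≡l))

  flipˡ : ∀ {i k j l : Fin (suc m)} → SharesEnd i k j l → SharesEnd k i j l
  flipˡ (inj₁ i≡j)               = inj₂ (inj₂ (inj₁ i≡j))
  flipˡ (inj₂ (inj₁ i≡l))        = inj₂ (inj₂ (inj₂ i≡l))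
  flipˡ (inj₂ (inj₂ (inj₁ k≡j))) = inj₁ k≡j
  flipˡ (inj₂ (inj₂ (inj₂ k≡l))) = inj₂ (inj₁ k≡l)

  crossEdges : ∀ {i k j l} → A i k ⊎ A k i → B j l ⊎ B l j → SharesEnd i k j l
  crossEdges (inj₁ Aik) (inj₁ Bjl) = cross Aik Bjl
  crossEdges (inj₁ Aik) (inj₂ Blj) = flipʳ (cross Aik Blj)
  crossEdges (inj₂ Aki) (inj₁ Bjl) = flipˡ (cross Aki Bjl)
  crossEdges (inj₂ Aki) (inj₂ Blj) = flipˡ (flipʳ (cross Aki Blj))

  -- An A-edge at a and a B-edge at a′ share an index, which can only be their outer end. So all
  -- these edges, {a , a′} aside, lead to a single third index, the last corner of the triangle.
  meet : ∀ {k l} → k ≢ a′ → A a k ⊎ A k a → l ≢ a → B a′ l ⊎ B l a′ → k ≡ l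
  meet k≢a′ Aak l≢a Ba′l with crossEdges Aak Ba′l
  ... | inj₁ a≡a′               = contradiction a≡a′ a≢a′
  ... | inj₂ (inj₁ a≡l)         = contradiction (≡.sym a≡l) l≢a
  ... | inj₂ (inj₂ (inj₁ k≡a′)) = contradiction k≡a′ k≢a′
  ... | inj₂ (inj₂ (inj₂ k≡l))  = k≡l

  A-head : ∀ {k} → A a k → k ≡ a′ ⊎ k ≡ y
  A-head {k} Aak with k ≟ a′
  ... | yes k≡a′ = inj₁ k≡a′
  ... | no k≢a′  = inj₂ (meet k≢a′ (inj₁ Aak) y≢a Ba′y)

  B-head : ∀ {l} → B a′ l → l ≡ a ⊎ l ≡ x
  B-head {l} Ba′l with l ≟ a
  ... | yes l≡a = inj₁ l≡a
  ... | no l≢a  = inj₂ (≡.sym (meet x≢a′ Aax l≢a (inj₁ Ba′l)))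

  triangle : ShortCover A B
  -- Arcs between a and a′ cannot occur in both A and B. If they are in A, then a′ → a can only be
  -- the exceptional arc b → a; if in B, then a → a′ can only be b′ → a′. So one fifth arc suffices.
  triangle with A? a a′ ⊎-dec A? a′ a
  ... | yes Aaa′ = C , ℕ.m≤m⊔n 5 (2 ℕ.+ m) , A⊆C , B⊆C
    where
    C = (a , y) ∷ (b , a) ∷ (a′ , x) ∷ (b′ , a′) ∷ (a , a′) ∷ []
    A⊆C : Covers A C
    A⊆C Aik with A-apex Aik
    ... | inj₂ (refl , refl) = there (here refl)
    ... | inj₁ refl with A-head Aik
    ...   | inj₁ refl = there (there (there (there (here refl))))
    ...   | inj₂ refl = here refl
    B⊆C : Covers B C
    B⊆C Bik with B-apex Bik
    ... | inj₂ (refl , refl) = there (there (there (here refl)))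
    ... | inj₁ refl with B-head Bik
    ...   | inj₁ refl = contradiction Bik ([ disjoint′ , disjoint ] Aaa′)
    ...   | inj₂ refl = there (there (here refl))
  ... | no ¬Aaa′ = C , ℕ.m≤m⊔n 5 (2 ℕ.+ m) , A⊆C , B⊆C
    where
    C = (a , y) ∷ (b , a) ∷ (a′ , x) ∷ (b′ , a′) ∷ (a′ , a) ∷ []
    A⊆C : Covers A C
    A⊆C Aik with A-apex Aik
    ... | inj₂ (refl , refl) = there (here refl)
    ... | inj₁ refl with A-head Aik
    ...   | inj₁ refl = contradiction (inj₁ Aik) ¬Aaa′
    ...   | inj₂ refl = here refl
    B⊆C : Covers B C
    B⊆C Bik with B-apex Bik
    ... | inj₂ (refl , refl) = there (there (there (here refl)))
    ... | inj₁ refl with B-head Bik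
    ...   | inj₁ refl = there (there (there (there (here refl))))
    ...   | inj₂ refl = there (there (here refl))

-- For m = 2 and d ≤ 1 there are 6 arcs but at most 5 are covered, so a triangle must not cost all
-- six. For m = 3 + t and d ≤ 2 + t, the product (4 + t)(3 + t) exceeds (2 + t)(5 + t) by 2.
arcCount : 2 ≤ m → suc m ℕ.* m ≤ d ℕ.* (5 ℕ.⊔ (2 ℕ.+ m)) → m ≤ d
arcCount {m} {d} 2≤m le with m ℕ.≤? d
... | yes m≤d = m≤d
... | no m≰d  = contradiction le (too-many 2≤m (ℕ.≰⇒> m≰d))
  where
  open ℕ-Solver.+-*-Solver
  too-many : ∀ {m d} → 2 ≤ m → suc d ≤ m → ¬ (suc m ℕ.* m ≤ d ℕ.* (5 ℕ.⊔ (2 ℕ.+ m)))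
  too-many {suc zero} (s≤s ())
  too-many {suc (suc zero)} {d} _ (s≤s d≤1) le =
    contradiction (ℕ.≤-trans le (ℕ.*-monoˡ-≤ 5 d≤1)) (ℕ.<⇒≱ ℕ.≤-refl)
  too-many {suc (suc (suc t))} {d} _ (s≤s d≤2+t) le = contradiction
    (ℕ.≤-trans le (ℕ.*-monoˡ-≤ (5 ℕ.+ t) d≤2+t))
    (ℕ.<⇒≱ (subst (suc ((2 ℕ.+ t) ℕ.* (5 ℕ.+ t)) ≤_)
      (solve 1 (λ t → con 1 :+ ((con 2 :+ t) :* (con 5 :+ t)) :+ con 1 :=
                      (con 4 :+ t) :* (con 3 :+ t)) refl t)
      (ℕ.m≤m+n _ 1)))

-- A list and a position in it determine the arc found there, so the arcs inject into the available
-- positions.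
cover-bound : 2 ≤ m → (C : Fin d → List (Arc (suc m))) →
  (∀ h → length (C h) ≤ 5 ℕ.⊔ (2 ℕ.+ m)) →
  (∀ i k → i ≢ k → ∃ λ h → (i , k) ∈ᴸ C h) → m ≤ d
cover-bound {m = m} {d = d} 2≤m C short covers = arcCount {m} {d} 2≤m (Fin.injective⇒≤ {f = f} f-injective)
  where
  position : ∀ {x} → (∃ λ h → x ∈ᴸ C h) → Fin (d ℕ.* (5 ℕ.⊔ (2 ℕ.+ m)))
  position (h , x∈) = combine h (inject≤ (index x∈) (short h))

  position-injective : ∀ {x y} p q → position {x} p ≡ position {y} q → x ≡ y
  position-injective (h , x∈) (h′ , y∈) eq
    with Fin.combine-injective h (inject≤ (index x∈) (short h)) h′ (inject≤ (index y∈) (short h′)) eq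
  ... | refl , eq′ = ≡.trans (lookup-index x∈) (≡.trans
    (cong (lookup (C h)) (Fin.inject≤-injective (short h) (short h) _ _ eq′)) (≡.sym (lookup-index y∈)))

  arc : Fin (suc m) × Fin m → Arc (suc m)
  arc (i , k) = i , punchIn i k

  arc-injective : ∀ x y → arc x ≡ arc y → x ≡ y
  arc-injective (i , k) (j , l) eq with cong proj₁ eq
  ... | refl = cong (i ,_) (Fin.punchIn-injective i k l (cong proj₂ eq))

  position-of : ∀ x → ∃ λ h → arc x ∈ᴸ C h
  position-of (i , k) = covers i (punchIn i k) (Fin.punchInᵢ≢i i k ∘ ≡.sym)

  f : Fin (suc m ℕ.* m) → Fin (d ℕ.* (5 ℕ.⊔ (2 ℕ.+ m)))
  f z = position (position-of (remQuot m z))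

  f-injective : ∀ {y z} → f y ≡ f z → y ≡ z
  f-injective {y} {z} eq = ≡.trans (≡.sym (Fin.combine-remQuot m y)) (≡.trans
    (cong (uncurry combine) (arc-injective (remQuot m y) (remQuot m z)
      (position-injective (position-of (remQuot m y)) (position-of (remQuot m z)) eq)))
    (Fin.combine-remQuot m z))

-- Interval and threshold graphs

-- Strict order in negated form: it is only used to refute inequalities or, via `≰ᴿ⇒≥ᴿ`, to get weak
-- ones.
Precedes : Interval → Interval → Set
Precedes I J = ¬ (lower J ≤ᴿ upper I)

Intersect⇒≤ : ∀ {I J} → Intersect I J → lower I ≤ᴿ upper J
Intersect⇒≤ {I} {J} (x , (lI≤x , _) , (_ , x≤uJ)) = ≤ᴿ-trans (lower I) x (upper J) lI≤x x≤uJ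

≤ᴿ-total-¬¬ : ∀ x y → ¬ ¬ (x ≤ᴿ y ⊎ y ≤ᴿ x)
≤ᴿ-total-¬¬ x y ¬total = ¬total (inj₂ (≰ᴿ⇒≥ᴿ {x} {y} (¬total ∘ inj₁)))

-- If neither interval precedes the other, the larger lower end lies in both; which end is larger is
-- known only up to double negation.
¬Intersect⇒¬¬Precedes : ∀ {I J} → ¬ Intersect I J → ¬ ¬ (Precedes I J ⊎ Precedes J I)
¬Intersect⇒¬¬Precedes {I} {J} ¬meet ¬apart =
  ¬apart (inj₁ λ lJ≤uI → ¬apart (inj₂ λ lI≤uJ → ≤ᴿ-total-¬¬ (lower I) (lower J) λ
    { (inj₁ lI≤lJ) → ¬meet (lower J , (lI≤lJ , lJ≤uI) , (≤ᴿ-refl (lower J) , lower≤upper J))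
    ; (inj₂ lJ≤lI) → ¬meet (lower I , (≤ᴿ-refl (lower I) , lower≤upper I) , (lJ≤lI , lI≤uJ))
    }))

-- Interval orders contain no 2 + 2: L begins by the end of I, hence before J begins, hence by the
-- end of K.
Precedes-2+2 : ∀ {I J K L} → Precedes I J → Precedes K L → Intersect I L → Intersect K J → ⊥
Precedes-2+2 {I} {J} {K} {L} I<J K<L I∩L K∩J = K<L
  (≤ᴿ-trans (lower L) (upper I) (upper K) (Intersect⇒≤ {L} {I} (swap {I} {L} I∩L))
    (≤ᴿ-trans (upper I) (lower J) (upper K) (≰ᴿ⇒≥ᴿ {lower J} {upper I} I<J) (Intersect⇒≤ {J} {K} (swap {K} {J} K∩J))))
  where
  swap : ∀ {I J} → Intersect I J → Intersect J I
  swap (x , x∈I , x∈J) = x , x∈J , x∈I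

module _ {V : Setoid ℓ₁ ℓ₂} where
  open Setoid V using (_≈_) renaming (Carrier to Vertex)
  open Graph

  _⊆ᴳ_ : Graph V → Graph V → Set _
  G ⊆ᴳ H = ∀ {v w} → Adj G v w → Adj H v w

  ∩⇒⊆ᴳ : ∀ {G : Graph V} {H : Fin d → Graph V} → IsIntersectionOf G H → ∀ j → G ⊆ᴳ H j
  ∩⇒⊆ᴳ {G = G} G≡⋂H j vw = ⇒ (G≡⋂H _ _ (λ v≈w → irrefl G v≈w vw)) vw j

  ∩-misses : ∀ {G : Graph V} {H : Fin d → Graph V} → IsIntersectionOf G H →
    ∀ {v w} → ¬ (v ≈ w) → ¬ Adj G v w → ¬ ¬ ∃ λ j → ¬ Adj (H j) v w
  ∩-misses G≡⋂H v≉w ¬vw ∄j = Fin-¬¬-∀ (λ j ¬vw-Hj → ∄j (j , ¬vw-Hj)) λ vw-H →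
    ¬vw (⇐ (G≡⋂H _ _ v≉w) vw-H)

  -- The two edges together weigh at least 2S and {v , w} weighs at most S, which leaves at least S
  -- for {v′ , w′}.
  threshold-no-alternating-4-cycle : ∀ {H : Graph V} → IsThresholdGraph H → ∀ {v w v′ w′} →
    ¬ (v ≈ w) → ¬ (v′ ≈ w′) → ¬ Adj H v w → ¬ Adj H v′ w′ →
    Adj H v w′ → Adj H v′ w → ⊥
  threshold-no-alternating-4-cycle (α , S , H≈T) {v} {w} {v′} {w′} v≉w v′≉w′ ¬vw ¬v′w′ vw′ v′w =
    ¬v′w′ (⇐ (H≈T v′ w′) (v′≉w′ ,
      ≤ᴿ-exchange S (to w′) (to v) (to w) (to v′) (proj₂ (⇒ (H≈T v w′) vw′)) (proj₂ (⇒ (H≈T v′ w) v′w))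
        (≰ᴿ⇒≥ᴿ {S} {to v +ᴿ to w} (λ S≤v+w → ¬vw (⇐ (H≈T v w) (v≉w , S≤v+w))))))
    where
    open Func α using (to)

  -- Each way of ordering the two missing diagonals is refuted by a pair of opposite sides of the
  -- 4-cycle.
  interval-no-C₄ : ∀ {H : Graph V} → IsIntervalGraph H → ∀ {v w v′ w′} →
    ¬ (v ≈ w) → ¬ (v′ ≈ w′) → ¬ Adj H v w → ¬ Adj H v′ w′ →
    Adj H v w′ → Adj H v′ w → Adj H v v′ → Adj H w w′ → ⊥
  interval-no-C₄ {H} (f , H≈I) {v} {w} {v′} {w′} v≉w v′≉w′ ¬vw ¬v′w′ vw′ v′w vv′ ww′ =
    ¬Intersect⇒¬¬Precedes {to v} {to w} (λ meet → ¬vw (⇐ (H≈I v w) (v≉w , meet))) λ vw-apart →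
    ¬Intersect⇒¬¬Precedes {to v′} {to w′} (λ meet → ¬v′w′ (⇐ (H≈I v′ w′) (v′≉w′ , meet))) λ v′w′-apart →
    impossible vw-apart v′w′-apart
    where
    open Func f
    meets : ∀ {x y} → Adj H x y → Intersect (to x) (to y)
    meets xy = proj₂ (⇒ (H≈I _ _) xy)
    impossible : Precedes (to v) (to w) ⊎ Precedes (to w) (to v) →
      Precedes (to v′) (to w′) ⊎ Precedes (to w′) (to v′) → ⊥
    impossible (inj₁ v<w) (inj₁ v′<w′) = Precedes-2+2 {to v} {to w} {to v′} {to w′} v<w v′<w′ (meets vw′) (meets v′w)
    impossible (inj₁ v<w) (inj₂ w′<v′) = Precedes-2+2 {to v} {to w} {to w′} {to v′} v<w w′<v′ (meets vv′) (meets (symm H ww′))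
    impossible (inj₂ w<v) (inj₁ v′<w′) = Precedes-2+2 {to w} {to v} {to v′} {to w′} w<v v′<w′ (meets ww′) (meets (symm H vv′))
    impossible (inj₂ w<v) (inj₂ w′<v′) = Precedes-2+2 {to w} {to v} {to w′} {to v′} w<v w′<v′ (meets (symm H v′w)) (meets (symm H vw′))

  -- Choosing for each non-edge a graph that misses it is injective by exclusivity. The choice
  -- exists up to double negation, which suffices as n ≤ d is decidable.
  exclusive-non-edges-bound : ∀ {G : Graph V} (x y : Fin n → Vertex) →
    (∀ i → ¬ (x i ≈ y i)) → (∀ i → ¬ Adj G (x i) (y i)) →
    ∀ {P : Pred (Graph V) p} →
    (∀ {H} → P H → G ⊆ᴳ H → ∀ {i k} → i ≢ k → ¬ Adj H (x i) (y i) → ¬ ¬ Adj H (x k) (y k)) →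
    ∀ {d} → IsIntersectionOfSome P G d → n ≤ d
  exclusive-non-edges-bound {n = n} {G = G} x y x≉y ¬xy exclusive {d} (H , PH , G≡⋂H) =
    decidable-stable (n ℕ.≤? d) λ n≰d →
    Fin-¬¬-∀ (λ i → ∩-misses {G = G} {H = H} G≡⋂H (x≉y i) (¬xy i)) λ misses →
    n≰d (Fin.injective⇒≤ {f = proj₁ ∘ misses} λ {i} {k} eq → decidable-stable (i ≟ k) λ i≢k →
      exclusive (PH (proj₁ (misses i))) (∩⇒⊆ᴳ {G = G} {H = H} G≡⋂H (proj₁ (misses i))) i≢k (proj₂ (misses i))
        (subst (λ j → ¬ Adj (H j) (x k) (y k)) (≡.sym eq) (proj₂ (misses k))))

  -- Arc i → k stands for the non-edge {s i , e i k}, where s i and e i k have supports {i} and {i , k}.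
  module _ {G : Graph V} (2≤m : 2 ≤ m) (s : Fin (suc m) → Vertex) (e : Fin (suc m) → Fin (suc m) → Vertex)
    (s≉e : ∀ {i k} → i ≢ k → ¬ (s i ≈ e i k)) (¬se : ∀ i k → ¬ Adj G (s i) (e i k))
    (ss : ∀ {i k} → i ≢ k → Adj G (s i) (s k))
    (se : ∀ {i k j} → j ≢ i → j ≢ k → Adj G (s j) (e i k))
    (ee : ∀ {i k j l} → ¬ SharesEnd i k j l → Adj G (e i k) (e j l))
    (e-comm : ∀ i k → e i k ≈ e k i) where

    module _ (H : Graph V) (G⊆H : G ⊆ᴳ H) (f : Func V Interval-setoid) (H≈I : H ≈ᴳ intervalGraph f) where
      open Func f using (to) renaming (cong to to-cong)

      private
        lo hi : Vertex → ℝ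
        lo = lower ∘ to
        hi = upper ∘ to

        lo≤hi : ∀ v → lo v ≤ᴿ hi v
        lo≤hi v = lower≤upper (to v)

        edge : ∀ {v w} → Adj G v w → lo v ≤ᴿ hi w
        edge {v} {w} vw = Intersect⇒≤ {to v} {to w} (proj₂ (⇒ (H≈I v w) (G⊆H vw)))

      Left Right : Fin (suc m) → Fin (suc m) → Set
      Left  i k = i ≢ k × Precedes (to (s i)) (to (e i k))
      Right i k = i ≢ k × Precedes (to (e i k)) (to (s i))

      ¬Adj⇒Left⊎Right : ∀ {i k} → i ≢ k → ¬ Adj H (s i) (e i k) → ¬ ¬ (Left i k ⊎ Right i k)
      ¬Adj⇒Left⊎Right {i} {k} i≢k ¬H ¬LR =
        ¬Intersect⇒¬¬Precedes {to (s i)} {to (e i k)}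
          (λ meet → ¬H (⇐ (H≈I (s i) (e i k)) (s≉e i≢k , meet)))
          (¬LR ∘ Sum.map (i≢k ,_) (i≢k ,_))

      -- `s j` meets `e i k`, which begins after `s i` has ended, so `s j` ends later than `s i`.
      -- `Right-above` is the mirror image.
      Left-below : ∀ {i k j} → Left i k → j ≢ i → j ≢ k → ¬ (hi (s j) ≤ᴿ hi (s i))
      Left-below {i} {k} {j} (_ , s<e) j≢i j≢k sj≤si = s<e
        (≤ᴿ-trans (lo (e i k)) (hi (s j)) (hi (s i)) (edge (symm G (se j≢i j≢k))) sj≤si)

      Right-above : ∀ {i k j} → Right i k → j ≢ i → j ≢ k → ¬ (lo (s i) ≤ᴿ lo (s j))
      Right-above {i} {k} {j} (_ , e<s) j≢i j≢k si≤sj = e<s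
        (≤ᴿ-trans (lo (s i)) (lo (s j)) (hi (e i k)) si≤sj (edge (se j≢i j≢k)))

      -- `e j l` ends before `s j` begins, `s j` begins by the end of `s i` since the two are equal
      -- or adjacent, and `s i` ends before `e i k` begins. So `e j l` lies entirely to the left of
      -- `e i k`.
      Left-Right-apart : ∀ {i k j l} → Left i k → Right j l → ¬ (lo (e i k) ≤ᴿ hi (e j l))
      Left-Right-apart {i} {k} {j} {l} (_ , si<e) (_ , e<sj) e≤e = e<sj
        (≤ᴿ-trans (lo (s j)) (hi (s i)) (hi (e j l)) sj≤si
          (≤ᴿ-trans (hi (s i)) (lo (e i k)) (hi (e j l)) (≰ᴿ⇒≥ᴿ {lo (e i k)} {hi (s i)} si<e) e≤e))
        where
        sj≤si : lo (s j) ≤ᴿ hi (s i)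
        sj≤si with j ≟ i
        ... | yes refl = lo≤hi (s i)
        ... | no j≢i   = edge (ss j≢i)

      -- Under the double negation both relations may be taken as decidable and the ends of the
      -- `s i` as totally ordered, which is what `apex` and `shortCover` ask for.
      Left-Right-cover : ¬ ¬ ShortCover Left Right
      Left-Right-cover ¬cover =
        Fin-¬¬-∀ (λ i → Fin-¬¬-∀ λ k → ¬¬-excluded-middle) λ Left? →
        Fin-¬¬-∀ (λ i → Fin-¬¬-∀ λ k → ¬¬-excluded-middle) λ Right? →
        Fin-¬¬-∀ (λ i → Fin-¬¬-∀ λ k → ≤ᴿ-total-¬¬ (hi (s i)) (hi (s k))) λ hi-total →
        Fin-¬¬-∀ (λ i → Fin-¬¬-∀ λ k → ≤ᴿ-total-¬¬ (lo (s k)) (lo (s i))) λ lo-total →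
        let _ , _ , Left-apex = apex Left Left? (λ i k → hi (s i) ≤ᴿ hi (s k)) hi-total
              (least (λ i k → hi (s i) ≤ᴿ hi (s k))
                (λ i j k → ≤ᴿ-trans (hi (s i)) (hi (s j)) (hi (s k))) hi-total)
              Left-below
            -- The order is reversed here, so that the interval beginning last is the least.
            _ , _ , Right-apex = apex Right Right? (λ i k → lo (s k) ≤ᴿ lo (s i)) lo-total
              (least (λ i k → lo (s k) ≤ᴿ lo (s i))
                (λ i j k j≤i k≤j → ≤ᴿ-trans (lo (s k)) (lo (s j)) (lo (s i)) k≤j j≤i) lo-total)
              Right-above
        in ¬cover (shortCover Left? Right? proj₁ proj₁
          (λ {i} {k} {j} {l} L R → decidable-stable
            (i ≟ j ⊎-dec i ≟ l ⊎-dec k ≟ j ⊎-dec k ≟ l)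
            λ ¬shares → Left-Right-apart L R (edge (ee ¬shares)))
          -- An arc in both relations, or in one with its reverse in the other, would put `e i k` to
          -- the left of itself.
          (λ {i} {k} L R → Left-Right-apart L R (lo≤hi (e i k)))
          (λ {i} {k} L R → Left-Right-apart L R
            (≤ᴿ-trans (lo (e i k)) (hi (e i k)) (hi (e k i)) (lo≤hi (e i k))
              (proj₁ (proj₂ (to-cong (e-comm i k))))))
          Left-apex Right-apex)

    -- Every arc is missed by some graph and hence lies in its cover; `cover-bound` then counts the
    -- arcs.
    boxicity-bound : ∀ {d} → IsIntersectionOfSome IsIntervalGraph G d → m ≤ d
    boxicity-bound {d} (H , intervals , G≡⋂H) = decidable-stable (m ℕ.≤? d) λ m≰d →
      Fin-¬¬-∀ (λ h → Left-Right-cover (H h) (⊆H h) (proj₁ (intervals h)) (proj₂ (intervals h))) λ cover →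
      Fin-¬¬-∀ (λ i → Fin-¬¬-∀ λ k → arc i k) λ arcs →
      m≰d (cover-bound 2≤m (proj₁ ∘ cover) (proj₁ ∘ proj₂ ∘ cover) λ i k i≢k →
        let h , LR = arcs i k i≢k
        in h , [ proj₁ (proj₂ (proj₂ (cover h))) , proj₂ (proj₂ (proj₂ (cover h))) ]′ LR)
      where
      ⊆H : ∀ h → G ⊆ᴳ H h
      ⊆H = ∩⇒⊆ᴳ {G = G} {H = H} G≡⋂H

      L⊎R : ∀ h i k → Set
      L⊎R h i k = Left (H h) (⊆H h) (proj₁ (intervals h)) (proj₂ (intervals h)) i k
                ⊎ Right (H h) (⊆H h) (proj₁ (intervals h)) (proj₂ (intervals h)) i k

      arc : ∀ i k → ¬ ¬ (i ≢ k → ∃ λ h → L⊎R h i k)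
      arc i k ¬arc with i ≟ k
      ... | yes i≡k = ¬arc λ i≢k → contradiction i≡k i≢k
      ... | no i≢k  = ∩-misses {G = G} {H = H} G≡⋂H (s≉e i≢k) (¬se i k) λ (h , ¬H) →
        ¬Adj⇒Left⊎Right (H h) (⊆H h) (proj₁ (intervals h)) (proj₂ (intervals h)) i≢k ¬H λ LR →
        ¬arc λ _ → h , LR

-- The two entries of a class say whether the support of a vertex contains the index i of the
-- graph and the index j of a lonely prime; v and w become adjacent iff their weights add up to 4.
-- The intervals are, in order of decreasing weight: everything, the right half, a point of the
-- right half, a point of the left half; the points are distinct for distinct vertices.
Class : Set
Class = Bool × Bool

weight : Class → ℕ
weight (false , false) = 4
weight (false , true)  = 3
weight (true  , false) = 1
weight (true  , true)  = 0

Compatible : Class → Class → Set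
Compatible x y = 4 ≤ weight x ℕ.+ weight y

module _ (N : ℕ) where
  -- Codes `k` lie below `N`, so they serve as points of the left half, and their shifts by `N` as
  -- points of the right half.
  left right : Class → ℕ → ℕ
  left (false , false) k = 0
  left (false , true)  k = N
  left (true  , false) k = N ℕ.+ k
  left (true  , true)  k = k
  right (false , _)     k = N ℕ.+ N
  right (true  , false) k = N ℕ.+ k
  right (true  , true)  k = k

  left≤2N : ∀ x {k} → k ℕ.< N → left x k ≤ N ℕ.+ N
  left≤2N (false , false) k<N = z≤n
  left≤2N (false , true)  k<N = ℕ.m≤m+n N N
  left≤2N (true  , false) k<N = ℕ.+-monoʳ-≤ N (ℕ.<⇒≤ k<N)
  left≤2N (true  , true)  k<N = ℕ.≤-trans (ℕ.<⇒≤ k<N) (ℕ.m≤m+n N N)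

  left≤right : ∀ x {k} → k ℕ.< N → left x k ≤ right x k
  left≤right (false , q)     k<N = left≤2N (false , q) k<N
  left≤right (true  , false) k<N = ℕ.≤-refl
  left≤right (true  , true)  k<N = ℕ.≤-refl

  Compatible⇒left≤right : ∀ x y {k l} → k ℕ.< N → Compatible x y → left x k ≤ right y l
  Compatible⇒left≤right x               (false , _)     k<N _ = left≤2N x k<N
  Compatible⇒left≤right (false , false) (true , _)      k<N _ = z≤n
  Compatible⇒left≤right (false , true)  (true , false)  k<N _ = ℕ.m≤m+n N _
  Compatible⇒left≤right (false , true)  (true , true)   k<N (s≤s (s≤s (s≤s ())))
  Compatible⇒left≤right (true , false)  (true , false)  k<N (s≤s (s≤s ()))
  Compatible⇒left≤right (true , false)  (true , true)   k<N (s≤s ())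
  Compatible⇒left≤right (true , true)   (true , false)  k<N (s≤s ())
  Compatible⇒left≤right (true , true)   (true , true)   k<N ()

  -- Incompatible classes are either two points of the same half, told apart by k ≢ l and both
  -- inequalities, or a left point against something inside the right half.
  left≤right⇒Compatible : ∀ x y {k l} → k ℕ.< N → l ℕ.< N → k ≢ l →
    left x k ≤ right y l → left y l ≤ right x k → Compatible x y
  left≤right⇒Compatible (false , false) y               _ _ _ _ _ = ℕ.m≤m+n 4 (weight y)
  left≤right⇒Compatible (false , true)  (false , false) _ _ _ _ _ = ℕ.m≤m+n 4 3
  left≤right⇒Compatible (false , true)  (false , true)  _ _ _ _ _ = ℕ.m≤m+n 4 2
  left≤right⇒Compatible (false , true)  (true , false)  _ _ _ _ _ = ℕ.≤-refl
  left≤right⇒Compatible (false , true)  (true , true)   _ l<N _ N≤l _ = contradiction N≤l (ℕ.<⇒≱ l<N)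
  left≤right⇒Compatible (true , false)  (false , false) _ _ _ _ _ = ℕ.m≤m+n 4 1
  left≤right⇒Compatible (true , false)  (false , true)  _ _ _ _ _ = ℕ.≤-refl
  left≤right⇒Compatible (true , false)  (true , false)  _ _ k≢l k≤l l≤k =
    contradiction (ℕ.≤-antisym (ℕ.+-cancelˡ-≤ N _ _ k≤l) (ℕ.+-cancelˡ-≤ N _ _ l≤k)) k≢l
  left≤right⇒Compatible (true , false)  (true , true)   _ l<N _ N+k≤l _ =
    contradiction (ℕ.≤-trans (ℕ.m≤m+n N _) N+k≤l) (ℕ.<⇒≱ l<N)
  left≤right⇒Compatible (true , true)   (false , false) _ _ _ _ _ = ℕ.≤-refl
  left≤right⇒Compatible (true , true)   (false , true)  k<N _ _ _ N≤k = contradiction N≤k (ℕ.<⇒≱ k<N)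
  left≤right⇒Compatible (true , true)   (true , false)  k<N _ _ _ N+l≤k =
    contradiction (ℕ.≤-trans (ℕ.m≤m+n N _) N+l≤k) (ℕ.<⇒≱ k<N)
  left≤right⇒Compatible (true , true)   (true , true)   _ _ k≢l k≤l l≤k = contradiction (ℕ.≤-antisym k≤l l≤k) k≢l

fromℕ-cong : ∀ {k l} → k ≡ l → fromℕ k ≈ᴿ fromℕ l
fromℕ-cong {k} refl = ≤ᴿ-refl (fromℕ k) , ≤ᴿ-refl (fromℕ k)

fromℕ-Interval : ∀ k l → k ≤ l → Interval
fromℕ-Interval k l k≤l = record { lower = fromℕ k ; upper = fromℕ l ; lower≤upper = fromℕ-mono-≤ k≤l }

module _ {V : Setoid ℓ₁ ℓ₂} {N : ℕ} (code : Setoid.Carrier V → Fin N)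
  (code-cong : ∀ {v w} → Setoid._≈_ V v w → code v ≡ code w)
  (code-injective : ∀ {v w} → code v ≡ code w → Setoid._≈_ V v w) where

  open Setoid V using (_≈_) renaming (Carrier to Vertex)
  open Graph

  module _ (f : Vertex → Class) (f-cong : ∀ {v w} → v ≈ w → f v ≡ f w) where

    thresholds : Func V ℝ-setoid
    thresholds = record
      { to = fromℕ ∘ weight ∘ f ; cong = λ v≈w → fromℕ-cong (cong weight (f-cong v≈w)) }

    Adj-threshold : ∀ {v w} → ¬ (v ≈ w) →
      Adj (thresholdGraph thresholds (fromℕ 4)) v w ⇔ Compatible (f v) (f w)
    Adj-threshold {v} {w} v≉w = mk⇔
      (λ (_ , le) → fromℕ-cancel-≤ (≤ᴿ-trans (fromℕ 4) (fromℕ x +ᴿ fromℕ y) (fromℕ (x ℕ.+ y)) le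
        (proj₁ (fromℕ-+ x y))))
      (λ le → v≉w , ≤ᴿ-trans (fromℕ 4) (fromℕ (x ℕ.+ y)) (fromℕ x +ᴿ fromℕ y) (fromℕ-mono-≤ le)
        (proj₂ (fromℕ-+ x y)))
      where
      x = weight (f v)
      y = weight (f w)

    position : Vertex → ℕ
    position = toℕ ∘ code

    position<N : ∀ v → position v ℕ.< N
    position<N v = Fin.toℕ<n (code v)

    intervals : Func V Interval-setoid
    intervals = record
      { to = λ v → fromℕ-Interval (left N (f v) (position v)) (right N (f v) (position v))
          (left≤right N (f v) (position<N v))
      ; cong = λ v≈w →
          fromℕ-cong (cong₂ (left N) (f-cong v≈w) (cong toℕ (code-cong v≈w))) ,
          fromℕ-cong (cong₂ (right N) (f-cong v≈w) (cong toℕ (code-cong v≈w)))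
      }

    Adj-interval : ∀ {v w} → ¬ (v ≈ w) → Adj (intervalGraph intervals) v w ⇔ Compatible (f v) (f w)
    Adj-interval {v} {w} v≉w = mk⇔
      (λ (_ , x , (lv≤x , x≤rv) , (lw≤x , x≤rw)) →
        left≤right⇒Compatible N (f v) (f w) (position<N v) (position<N w)
          (v≉w ∘ code-injective ∘ Fin.toℕ-injective)
          (fromℕ-cancel-≤ (≤ᴿ-trans (fromℕ (left N (f v) (position v))) x (fromℕ (right N (f w) (position w))) lv≤x x≤rw))
          (fromℕ-cancel-≤ (≤ᴿ-trans (fromℕ (left N (f w) (position w))) x (fromℕ (right N (f v) (position v))) lw≤x x≤rv)))
      (λ compat → v≉w , intersect
        (Compatible⇒left≤right N (f v) (f w) (position<N v) compat)
        (Compatible⇒left≤right N (f w) (f v) (position<N w)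
          (subst (4 ≤_) (ℕ.+-comm (weight (f v)) (weight (f w))) compat)))
      where
      open Func intervals using (to)
      intersect : left N (f v) (position v) ≤ right N (f w) (position w) →
        left N (f w) (position w) ≤ right N (f v) (position v) → Intersect (to v) (to w)
      intersect lv≤rw lw≤rv = fromℕ (left N (f v) (position v) ℕ.⊔ left N (f w) (position w)) ,
        (fromℕ-mono-≤ (ℕ.m≤m⊔n (left N (f v) (position v)) _) ,
         fromℕ-mono-≤ (ℕ.⊔-lub (left≤right N (f v) (position<N v)) lw≤rv)) ,
        (fromℕ-mono-≤ (ℕ.m≤n⊔m (left N (f v) (position v)) _) ,
         fromℕ-mono-≤ (ℕ.⊔-lub lv≤rw (left≤right N (f w) (position<N w))))

  ≈ᴳ-refl : ∀ (G : Graph V) → G ≈ᴳ G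
  ≈ᴳ-refl G v w = mk⇔ id id

  -- The same classes feed both constructions, so each upper bound is proved once for both
  -- parameters.
  represent : ∀ {G : Graph V} (f : Fin d → Vertex → Class) →
    (∀ j {v w} → v ≈ w → f j v ≡ f j w) →
    (∀ v w → ¬ (v ≈ w) → Adj G v w ⇔ (∀ j → Compatible (f j v) (f j w))) →
    IsIntersectionOfSome IsIntervalGraph G d × IsIntersectionOfSome IsThresholdGraph G d
  represent {G = G} f f-cong G-compat =
    ((λ j → intervalGraph (intervals (f j) (f-cong j))) , (λ j → intervals (f j) (f-cong j) , ≈ᴳ-refl (intervalGraph (intervals (f j) (f-cong j)))) ,
     λ v w v≉w → mk⇔
       (λ vw j → ⇐ (Adj-interval (f j) (f-cong j) v≉w) (⇒ (G-compat v w v≉w) vw j))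
       (λ H → ⇐ (G-compat v w v≉w) λ j → ⇒ (Adj-interval (f j) (f-cong j) v≉w) (H j))) ,
    ((λ j → thresholdGraph (thresholds (f j) (f-cong j)) (fromℕ 4)) ,
     (λ j → thresholds (f j) (f-cong j) , fromℕ 4 ,
       ≈ᴳ-refl (thresholdGraph (thresholds (f j) (f-cong j)) (fromℕ 4))) ,
     λ v w v≉w → mk⇔
       (λ vw j → ⇐ (Adj-threshold (f j) (f-cong j) v≉w) (⇒ (G-compat v w v≉w) vw j))
       (λ H → ⇐ (G-compat v w v≉w) λ j → ⇒ (Adj-threshold (f j) (f-cong j) v≉w) (H j)))

-- Finite reduced rings

module FiniteReducedRing {c ℓ} (R : CommutativeRing c ℓ)
  (finite : IsFinite (CommutativeRing.setoid R)) (reduced : RingDefs.IsReduced R) where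

  open CommutativeRing R hiding (zero; refl)
  open RingDefs R
  open import Algebra.Properties.Ring ring using (-‿distribʳ-*; -1*x≈-x)
  open import Algebra.Properties.Semiring.Exp semiring using (_^_; ^-homo-*; ^-congʳ)
  open import Algebra.Properties.CommutativeSemiring.Exp commutativeSemiring using (^-distrib-*)
  open import Algebra.Properties.CommutativeSemigroup *-commutativeSemigroup
    using (interchange; xy∙z≈xz∙y; x∙yz≈y∙xz)
  open import Relation.Binary.Reasoning.Setoid setoid

  size : ℕ
  size = proj₁ finite

  open Inverse (proj₂ finite) public
    using () renaming (to to code; from to decode; to-cong to code-cong; strictlyInverseʳ to decode-code)

  code-injective : ∀ {x y} → code x ≡ code y → x ≈ y
  code-injective {x} {y} eq = trans (sym (decode-code x)) (trans (reflexive (cong decode eq)) (decode-code y))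

  infix 4 _≈?_
  _≈?_ : ∀ x y → Dec (x ≈ y)
  x ≈? y = map′ code-injective code-cong (code x Fin.≟ code y)

  search : ∀ {q} {P : Pred Carrier q} → (∀ {x y} → x ≈ y → x ∈ P → y ∈ P) →
    (∀ x → Dec (x ∈ P)) → Dec (∃ P)
  search resp P? = map′ (λ (i , Pi) → decode i , Pi)
    (λ (x , Px) → code x , resp (sym (decode-code x)) Px) (any? (P? ∘ decode))

  x*x≈0⇒x≈0 : ∀ {x} → x * x ≈ 0# → x ≈ 0#
  x*x≈0⇒x≈0 {x} xx≈0 = reduced x (2 , trans (*-congˡ (*-identityʳ x)) xx≈0)

  -- Von Neumann regularity. Two powers of x agree by the pigeonhole principle, so some power of x
  -- kills z = 1 - xy. Then xz is nilpotent, hence 0.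
  regular : ∀ x → ∃ λ y → x * (1# - x * y) ≈ 0#
  regular x with i , j , i<j , eq ← Fin.pigeonhole (ℕ.n<1+n size) (λ t → code (x ^ toℕ t)) =
    -- The exponent `suc a` provides a factor z beside `x ^ a` even if a = 0.
    y , reduced (x * z) (suc a , (begin
      (x * z) ^ suc a          ≈⟨ ^-distrib-* x z (suc a) ⟩
      (x * x ^ a) * (z * z ^ a) ≈⟨ *-congˡ (*-comm z (z ^ a)) ⟩
      (x * x ^ a) * (z ^ a * z) ≈⟨ interchange x (x ^ a) (z ^ a) z ⟩
      (x * z ^ a) * (x ^ a * z) ≈⟨ *-congˡ xᵃz≈0 ⟩
      (x * z ^ a) * 0#          ≈⟨ zeroʳ _ ⟩
      0#                        ∎))
    where
    a = toℕ i
    -- The subtraction is exact as a < j, and a + (k + 1) = j.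
    k = toℕ j ℕ.∸ suc a
    y = x ^ k
    z = 1# - x * y
    xᵃ≈xᵃxy : x ^ a ≈ x ^ a * (x * y)
    xᵃ≈xᵃxy = begin
      x ^ a             ≈⟨ code-injective eq ⟩
      x ^ toℕ j         ≈⟨ ^-congʳ x (≡.trans (≡.sym (ℕ.m+[n∸m]≡n i<j)) (≡.sym (ℕ.+-suc a k))) ⟩
      x ^ (a ℕ.+ suc k) ≈⟨ ^-homo-* x a (suc k) ⟩
      x ^ a * (x * y)   ∎
    xᵃz≈0 : x ^ a * z ≈ 0#
    xᵃz≈0 = begin
      x ^ a * (1# - x * y)               ≈⟨ distribˡ (x ^ a) 1# (- (x * y)) ⟩
      x ^ a * 1# + x ^ a * - (x * y)     ≈⟨ +-cong (*-identityʳ _) (sym (-‿distribʳ-* _ _)) ⟩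
      x ^ a - x ^ a * (x * y)            ≈⟨ +-congʳ xᵃ≈xᵃxy ⟩
      x ^ a * (x * y) - x ^ a * (x * y)  ≈⟨ -‿inverseʳ _ ⟩
      0#                                 ∎

  module _ {p} {P : Pred Carrier p} (P-prime : IsPrimeIdeal P) where
    open IsPrimeIdeal P-prime
    open IsIdeal isIdeal

    abstract
      -- By regularity x or 1 - xy lies in P. The latter rules out x, since 1 = (1 - xy) + yx is not
      -- in P.
      ∈-prime? : ∀ x → Dec (x ∈ P)
      ∈-prime? x with y , xz≈0 ← regular x with prime (resp (sym xz≈0) 0#-mem)
      ... | inj₁ x∈P = yes x∈P
      ... | inj₂ z∈P = no λ x∈P → proper (resp (1-xy+yx≈1 y) (+-closed z∈P (*-closed y x∈P)))
        where
        1-xy+yx≈1 : ∀ y → (1# - x * y) + y * x ≈ 1#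
        1-xy+yx≈1 y = begin
          (1# - x * y) + y * x       ≈⟨ +-assoc 1# _ _ ⟩
          1# + (- (x * y) + y * x)   ≈⟨ +-congˡ (+-congˡ (*-comm y x)) ⟩
          1# + (- (x * y) + x * y)   ≈⟨ +-congˡ (-‿inverseˡ _) ⟩
          1# + 0#                    ≈⟨ +-identityʳ 1# ⟩
          1#                         ∎

    *-closedʳ : ∀ {x} y → x ∈ P → x * y ∈ P
    *-closedʳ y x∈P = resp (*-comm y _) (*-closed y x∈P)

    +-cancelʳ-∈ : ∀ {x y} → x + y ∈ P → y ∈ P → x ∈ P
    +-cancelʳ-∈ {x} {y} x+y∈P y∈P = resp (begin
      (x + y) + - 1# * y   ≈⟨ +-congˡ (-1*x≈-x y) ⟩
      (x + y) - y          ≈⟨ +-assoc x y (- y) ⟩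
      x + (y - y)          ≈⟨ +-congˡ (-‿inverseʳ y) ⟩
      x + 0#               ≈⟨ +-identityʳ x ⟩
      x                    ∎) (+-closed x+y∈P (*-closed (- 1#) y∈P))

  product : (Fin n → Carrier) → Carrier
  product {zero}  f = 1#
  product {suc n} f = f zero * product (f ∘ suc)

  product-∈ : ∀ {p} {P : Pred Carrier p} → IsPrimeIdeal P →
    (f : Fin n → Carrier) → ∀ i → f i ∈ P → product f ∈ P
  product-∈ P-prime f zero    fi∈P = *-closedʳ P-prime _ fi∈P
  product-∈ P-prime f (suc i) fi∈P =
    IsIdeal.*-closed (IsPrimeIdeal.isIdeal P-prime) (f zero) (product-∈ P-prime (f ∘ suc) i fi∈P)

  product-∉ : ∀ {p} {P : Pred Carrier p} → IsPrimeIdeal P →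
    (f : Fin n → Carrier) → (∀ i → f i ∉ P) → product f ∉ P
  product-∉ {zero}  P-prime f f∉P 1∈P = IsPrimeIdeal.proper P-prime 1∈P
  product-∉ {suc n} P-prime f f∉P f₀f∈P =
    [ f∉P zero , product-∉ P-prime (f ∘ suc) (f∉P ∘ suc) ] (IsPrimeIdeal.prime P-prime f₀f∈P)

  -- Multiply x successively by every listed element that does not kill it.  The annihilator
  -- of the result is then prime, the ring being reduced.
  saturate : (z : Fin n → Carrier) → ∀ {x} → ¬ (x ≈ 0#) →
    ∃ λ w → ¬ (w ≈ 0#) × (∃ λ t → w ≈ x * t) × (∀ i → w * z i ≈ 0# ⊎ (∃ λ t → w ≈ z i * t))
  saturate {zero}  z {x} x≉0 = x , x≉0 , (1# , sym (*-identityʳ x)) , λ ()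
  saturate {suc n} z {x} x≉0
    with w , w≉0 , (t , w≈xt) , w-sat ← saturate (z ∘ suc) x≉0
    with w * z zero ≈? 0#
  ... | yes wz≈0 = w , w≉0 , (t , w≈xt) , λ { zero → inj₁ wz≈0 ; (suc i) → w-sat i }
  ... | no wz≉0 = w * z zero , wz≉0 , (t * z zero , trans (*-congʳ w≈xt) (*-assoc x t (z zero))) , λ
    { zero    → inj₂ (w , *-comm w (z zero))
    ; (suc i) → Sum.map
        (λ wzᵢ≈0 → trans (xy∙z≈xz∙y w (z zero) (z (suc i))) (trans (*-congʳ wzᵢ≈0) (zeroˡ (z zero))))
        (λ (s , w≈zᵢs) → s * z zero , trans (*-congʳ w≈zᵢs) (*-assoc (z (suc i)) s (z zero)))
        (w-sat i)
    }

  -- P is the annihilator of the saturated multiple w of x. If it contained x, then w² = 0. A prime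
  -- Q inside P does not contain w, so from wy = 0 it contains every y in P.
  ∃-minimal-prime-∌ : ∀ p {x} → ¬ (x ≈ 0#) → ∃ λ (P : Pred Carrier p) → IsMinimalPrimeIdeal P × x ∉ P
  ∃-minimal-prime-∌ p {x} x≉0 with w , w≉0 , (t , w≈xt) , w-sat ← saturate decode x≉0 =
    P , record { isPrimeIdeal = P-prime ; minimal = P-minimal } , x∉P
    where
    P : Pred Carrier p
    -- Decidability allows the annihilator to live in the level `p` of the given family of primes.
    P y = Lift p (True (w * y ≈? 0#))

    to-P : ∀ {y} → w * y ≈ 0# → y ∈ P
    to-P wy≈0 = lift (fromWitness wy≈0)

    from-P : ∀ {y} → y ∈ P → w * y ≈ 0#
    from-P y∈P = toWitness (Level.lower y∈P)

    divides-w : ∀ {y} → y ∉ P → ∃ λ s → w ≈ y * s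
    divides-w {y} y∉P with w-sat (code y)
    ... | inj₁ wy≈0       = contradiction (to-P (trans (*-congˡ (sym (decode-code y))) wy≈0)) y∉P
    ... | inj₂ (s , w≈ys) = s , trans w≈ys (*-congʳ (decode-code y))

    w∉P : w ∉ P
    w∉P w∈P = w≉0 (x*x≈0⇒x≈0 (from-P w∈P))

    x∉P : x ∉ P
    x∉P x∈P = w∉P (to-P (begin
      w * w        ≈⟨ *-congˡ w≈xt ⟩
      w * (x * t)  ≈⟨ *-assoc w x t ⟨
      (w * x) * t  ≈⟨ *-congʳ (from-P x∈P) ⟩
      0# * t       ≈⟨ zeroˡ t ⟩
      0#           ∎))

    P-ideal : IsIdeal P
    P-ideal = record
      { resp     = λ x≈y x∈P → to-P (trans (*-congˡ (sym x≈y)) (from-P x∈P))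
      ; 0#-mem   = to-P (zeroʳ w)
      ; +-closed = λ x∈P y∈P → to-P (trans (distribˡ w _ _)
          (trans (+-cong (from-P x∈P) (from-P y∈P)) (+-identityʳ 0#)))
      ; *-closed = λ r x∈P → to-P (trans (x∙yz≈y∙xz w r _) (trans (*-congˡ (from-P x∈P)) (zeroʳ r)))
      }

    P-prime : IsPrimeIdeal P
    P-prime = record { isIdeal = P-ideal ; proper = proper ; prime = prime }
      where
      proper : 1# ∉ P
      proper 1∈P = w≉0 (trans (sym (*-identityʳ w)) (from-P 1∈P))

      prime : ∀ {y z} → y * z ∈ P → y ∈ P ⊎ z ∈ P
      prime {y} {z} yz∈P with toSum (w * y ≈? 0#)
      ... | inj₁ wy≈0 = inj₁ (to-P wy≈0)
      -- As w = ys, the square of wz has the factor w(yz) = 0.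
      ... | inj₂ wy≉0 with s , w≈ys ← divides-w (wy≉0 ∘ from-P) =
        inj₂ (to-P (x*x≈0⇒x≈0 (begin
          (w * z) * (w * z)       ≈⟨ *-congˡ (*-congʳ w≈ys) ⟩
          (w * z) * ((y * s) * z) ≈⟨ *-congˡ (xy∙z≈xz∙y y s z) ⟩
          (w * z) * ((y * z) * s) ≈⟨ interchange w z (y * z) s ⟩
          (w * (y * z)) * (z * s) ≈⟨ *-congʳ (from-P yz∈P) ⟩
          0# * (z * s)            ≈⟨ zeroˡ (z * s) ⟩
          0#                      ∎)))

    P-minimal : ∀ (Q : Pred Carrier p) → IsPrimeIdeal Q → Q ⊆ P → P ⊆ Q
    P-minimal Q Q-prime Q⊆P y∈P
      with IsPrimeIdeal.prime Q-prime (IsIdeal.resp (IsPrimeIdeal.isIdeal Q-prime)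
             (sym (from-P y∈P)) (IsIdeal.0#-mem (IsPrimeIdeal.isIdeal Q-prime)))
    ... | inj₁ w∈Q = contradiction (Q⊆P w∈Q) w∉P
    ... | inj₂ y∈Q = y∈Q

  -- Elements with prescribed membership in the minimal primes

  module MinimalPrimes {p} {n} (M : Fin n → Pred Carrier p) (all-M : AreTheMinimalPrimeIdeals M) where
    open AreTheMinimalPrimeIdeals all-M

    M-prime : ∀ i → IsPrimeIdeal (M i)
    M-prime i = IsMinimalPrimeIdeal.isPrimeIdeal (isMinimalPrime i)

    module M i = IsPrimeIdeal (M-prime i)
    module M-ideal i = IsIdeal (M.isIdeal i)

    _∈M?_ : ∀ x i → Dec (x ∈ M i)
    x ∈M? i = ∈-prime? (M-prime i) x

    ≈0⇒∈M : ∀ {x} → x ≈ 0# → ∀ i → x ∈ M i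
    ≈0⇒∈M x≈0 i = M-ideal.resp i (sym x≈0) (M-ideal.0#-mem i)

    -- A nonzero x is avoided by some minimal prime, and that prime is one of the `M i`.
    ∈⋂M⇒≈0 : ∀ {x} → (∀ i → x ∈ M i) → x ≈ 0#
    ∈⋂M⇒≈0 {x} x∈M = decidable-stable (x ≈? 0#) λ x≉0 →
      let P , P-minimal , x∉P = ∃-minimal-prime-∌ p x≉0
          i , _ , Mi⊆P = exhaustive P P-minimal
      in x∉P (Mi⊆P (x∈M i))

    *≈0⇒∈M : ∀ {x y} → x * y ≈ 0# → ∀ i → x ∈ M i ⊎ y ∈ M i
    *≈0⇒∈M xy≈0 i = M.prime i (≈0⇒∈M xy≈0 i)

    ∈M⇒*≈0 : ∀ {x y} → (∀ i → x ∈ M i ⊎ y ∈ M i) → x * y ≈ 0#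
    ∈M⇒*≈0 {x} {y} x∈M⊎y∈M = ∈⋂M⇒≈0 λ i →
      [ *-closedʳ (M-prime i) y , M-ideal.*-closed i x ] (x∈M⊎y∈M i)

    -- If the search of the finite ring fails, M i ⊆ M j, and minimality of M j makes the two equal.
    ∃-∈M-∉M : ∀ {i j} → i ≢ j → ∃ λ x → x ∈ M i × x ∉ M j
    ∃-∈M-∉M {i} {j} i≢j with search
      (λ x≈y (x∈Mi , x∉Mj) → M-ideal.resp i x≈y x∈Mi , x∉Mj ∘ M-ideal.resp j (sym x≈y))
      (λ x → x ∈M? i ×-dec ¬? (x ∈M? j))
    ... | yes found = found
    ... | no ∄x = contradiction (distinct i j (Mi⊆Mj , Mj⊆Mi)) i≢j
      where
      Mi⊆Mj : M i ⊆ M j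
      Mi⊆Mj {x} x∈Mi = decidable-stable (x ∈M? j) λ x∉Mj → ∄x (x , x∈Mi , x∉Mj)
      Mj⊆Mi : M j ⊆ M i
      Mj⊆Mi = IsMinimalPrimeIdeal.minimal (isMinimalPrime j) (M i) (M-prime i) Mi⊆Mj

    -- For each i ≢ j take a factor in M i outside M j, and 1 for j itself. The product stays
    -- outside M j by primality.
    ∃-OnlyOutside : ∀ j → ∃ (OnlyOutside M j)
    ∃-OnlyOutside j = product (proj₁ ∘ factor) ,
      (λ i i≢j → product-∈ (M-prime i) (proj₁ ∘ factor) i (proj₁ (proj₂ (factor i)) i≢j)) ,
      product-∉ (M-prime j) (proj₁ ∘ factor) (proj₂ ∘ proj₂ ∘ factor)
      where
      factor : ∀ i → ∃ λ x → (i ≢ j → x ∈ M i) × x ∉ M j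
      factor i with i Fin.≟ j
      ... | yes i≡j = 1# , (λ i≢j → contradiction i≡j i≢j) , M.proper j
      ... | no i≢j with x , x∈Mi , x∉Mj ← ∃-∈M-∉M i≢j = x , (λ _ → x∈Mi) , x∉Mj

    OnlyOutside? : ∀ j x → Dec (OnlyOutside M j x)
    OnlyOutside? j x = all? (λ i → ¬? (i Fin.≟ j) →-dec (x ∈M? i)) ×-dec ¬? (x ∈M? j)

    OnlyOutside-resp : ∀ j {x y} → x ≈ y → OnlyOutside M j x → OnlyOutside M j y
    OnlyOutside-resp j x≈y (x∈M , x∉Mj) =
      (λ i i≢j → M-ideal.resp i x≈y (x∈M i i≢j)) , x∉Mj ∘ M-ideal.resp j (sym x≈y)

    ¬Lonely⇒∃-other : ∀ {j} → ¬ Lonely M j → ∀ {x} → OnlyOutside M j x →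
      ∃ λ y → OnlyOutside M j y × ¬ (x ≈ y)
    ¬Lonely⇒∃-other {j} ¬lonely {x} x-only with search
      (λ y≈z (y-only , x≉y) → OnlyOutside-resp j y≈z y-only , λ x≈z → x≉y (trans x≈z (sym y≈z)))
      (λ y → OnlyOutside? j y ×-dec ¬? (x ≈? y))
    ... | yes found = found
    ... | no ∄y = contradiction (x , x-only , λ y y-only →
      decidable-stable (x ≈? y) λ x≉y → ∄y (y , y-only , x≉y)) ¬lonely

-- The zero divisor graph

Compatible-intro : ∀ {p q p′ q′} → p ≡ false ⊎ p′ ≡ false → q ≡ false ⊎ q′ ≡ false →
  Compatible (p , q) (p′ , q′)
Compatible-intro {p′ = p′} {q′} (inj₁ refl) (inj₁ refl) = ℕ.m≤m+n 4 (weight (p′ , q′))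
Compatible-intro {p} {q} (inj₂ refl) (inj₂ refl) = ℕ.m≤n+m 4 (weight (p , q))
Compatible-intro {q = false} {p′} (inj₁ refl) (inj₂ refl) = ℕ.m≤m+n 4 (weight (p′ , false))
Compatible-intro {q = true} {false} (inj₁ refl) (inj₂ refl) = ℕ.m≤m+n 4 3
Compatible-intro {q = true} {true} (inj₁ refl) (inj₂ refl) = ℕ.≤-refl
Compatible-intro {false} {q′ = q′} (inj₂ refl) (inj₁ refl) = ℕ.m≤m+n 4 (weight (false , q′))
Compatible-intro {true} {q′ = false} (inj₂ refl) (inj₁ refl) = ℕ.m≤m+n 4 1
Compatible-intro {true} {q′ = true} (inj₂ refl) (inj₁ refl) = ℕ.≤-refl

Compatible⇒false : ∀ {p q p′ q′} → Compatible (p , q) (p′ , q′) → p ≡ false ⊎ p′ ≡ false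
Compatible⇒false {false} _ = inj₁ refl
Compatible⇒false {true} {p′ = false} _ = inj₂ refl
Compatible⇒false {true} {false} {true} {false} (s≤s (s≤s ()))
Compatible⇒false {true} {false} {true} {true} (s≤s ())
Compatible⇒false {true} {true} {true} {false} (s≤s ())
Compatible⇒false {true} {true} {true} {true} ()

-- The weights are 3 or 0 here, so only 3 + 3 reaches 4. This replaces the graph of the lonely
-- index.
Compatible-true⇒false : ∀ {p p′} → Compatible (p , true) (p′ , true) → p ≡ false × p′ ≡ false
Compatible-true⇒false {false} {false} _ = refl , refl
Compatible-true⇒false {false} {true} (s≤s (s≤s (s≤s ())))
Compatible-true⇒false {true} {false} (s≤s (s≤s (s≤s ())))
Compatible-true⇒false {true} {true} ()

module ZeroDivisorGraph {c ℓ p} (R : CommutativeRing c ℓ)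
  (finite : IsFinite (CommutativeRing.setoid R)) (reduced : RingDefs.IsReduced R)
  {n : ℕ} (M : Fin n → Pred (CommutativeRing.Carrier R) p)
  (all-M : RingDefs.AreTheMinimalPrimeIdeals R M) where

  open CommutativeRing R hiding (zero; refl)
  open RingDefs R
  open FiniteReducedRing R finite reduced
  open MinimalPrimes M all-M
  open Graph Γ using (Adj; irrefl; symm)
  open Setoid Γ-vertices using () renaming (Carrier to Vertex; _≈_ to _≈ⱽ_)

  BothEqual : ℕ → Set (c ⊔ Level.suc ℓ)
  BothEqual d = IsBoxicity Γ d × IsThresholdDimension Γ d

  Adj⇔ : ∀ {v w : Vertex} → ¬ (v ≈ⱽ w) → Adj v w ⇔ (∀ i → proj₁ v ∈ M i ⊎ proj₁ w ∈ M i)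
  Adj⇔ v≉w = mk⇔ (*≈0⇒∈M ∘ proj₂) (λ ∈M → v≉w , ∈M⇒*≈0 ∈M)

  -- If v and w were equal, the second hypothesis at i would put v into M i.
  Adj-intro : ∀ {v w : Vertex} i → proj₁ v ∉ M i →
    (∀ l → proj₁ v ∈ M l ⊎ proj₁ w ∈ M l) → Adj v w
  Adj-intro {v} {w} i v∉Mi ∈M = ⇐ (Adj⇔ {v} {w} (λ v≈w →
    [ v∉Mi , v∉Mi ∘ M-ideal.resp i (sym v≈w) ] (∈M i))) ∈M

  ¬Adj-intro : ∀ {v w : Vertex} i → proj₁ v ∉ M i → proj₁ w ∉ M i → ¬ Adj v w
  ¬Adj-intro {v} {w} i v∉Mi w∉Mi vw = [ v∉Mi , w∉Mi ] (*≈0⇒∈M (proj₂ vw) i)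

  -- Supports are proper: if x avoided all the primes, its nonzero annihilator s would lie in all of
  -- them.
  ∃-∈M : ∀ (v : Vertex) → ∃ λ l → proj₁ v ∈ M l
  ∃-∈M (x , (s , s≉0 , xs≈0) , x≉0) with any? (x ∈M?_)
  ... | yes found = found
  ... | no ∄l = contradiction
    (∈⋂M⇒≈0 λ l → [ (λ x∈Ml → contradiction (l , x∈Ml) ∄l) , id ] (*≈0⇒∈M xs≈0 l)) s≉0

  -- An element with support {l} kills x, because x lies in M l.
  vertex : ∀ x {i l} → x ∉ M i → x ∈ M l → Vertex
  vertex x {i} {l} x∉Mi x∈Ml = x , (u , u≉0 , ∈M⇒*≈0 x∈M⊎u∈M) , λ x≈0 → x∉Mi (≈0⇒∈M x≈0 i)
    where
    u = proj₁ (∃-OnlyOutside l)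
    u-only = proj₂ (∃-OnlyOutside l)
    u≉0 : ¬ (u ≈ 0#)
    u≉0 u≈0 = proj₂ u-only (≈0⇒∈M u≈0 l)
    x∈M⊎u∈M : ∀ k → x ∈ M k ⊎ u ∈ M k
    x∈M⊎u∈M k with k ≟ l
    ... | yes refl = inj₁ x∈Ml
    ... | no k≢l   = inj₂ (proj₁ u-only k k≢l)

  OnlyOutside-Adj : ∀ {v w : Vertex} {i k} → i ≢ k →
    OnlyOutside M i (proj₁ v) → OnlyOutside M k (proj₁ w) → Adj v w
  OnlyOutside-Adj {v} {w} {i} {k} i≢k (v∈M , v∉Mi) (w∈M , _) = Adj-intro {v} {w} i v∉Mi ∈M
    where
    ∈M : ∀ l → proj₁ v ∈ M l ⊎ proj₁ w ∈ M l
    ∈M l with l ≟ i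
    ... | yes refl = inj₂ (w∈M l i≢k)
    ... | no l≢i   = inj₁ (v∈M l l≢i)

  complete⇒0 : (∀ v w → ¬ (v ≈ⱽ w) → Adj v w) → BothEqual 0
  complete⇒0 complete = (zero-dim {P = IsIntervalGraph} , λ _ _ → z≤n) , (zero-dim {P = IsThresholdGraph} , λ _ _ → z≤n)
    where
    zero-dim : ∀ {q} {P : Pred (Graph Γ-vertices) q} → IsIntersectionOfSome P Γ 0
    zero-dim = (λ ()) , (λ ()) , λ v w v≉w → mk⇔ (λ _ ()) (λ _ → complete v w v≉w)

  -- Treats n = 1 and n = 2 together. Two vertices outside the same M i both have support {i},
  -- supports being proper, and loneliness makes them equal.
  few-primes-complete : (∀ {i k l : Fin n} → k ≢ i → l ≢ i → k ≡ l) →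
    (∀ {i l} → l ≢ i → Lonely M i) → ∀ v w → ¬ (v ≈ⱽ w) → Adj v w
  few-primes-complete n≤2 lonely v w v≉w = ⇐ (Adj⇔ {v} {w} v≉w) ∈M
    where
    only : ∀ {i} (v : Vertex) → proj₁ v ∉ M i → OnlyOutside M i (proj₁ v)
    only {i} v v∉Mi with l , v∈Ml ← ∃-∈M v =
      (λ k k≢i → subst (λ k → proj₁ v ∈ M k) (n≤2 (λ { refl → v∉Mi v∈Ml }) k≢i) v∈Ml) , v∉Mi

    ∈M : ∀ i → proj₁ v ∈ M i ⊎ proj₁ w ∈ M i
    ∈M i with proj₁ v ∈M? i | proj₁ w ∈M? i
    ... | yes v∈Mi | _        = inj₁ v∈Mi
    ... | no _     | yes w∈Mi = inj₂ w∈Mi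
    ... | no v∉Mi  | no w∉Mi
      with l , v∈Ml ← ∃-∈M v
      with x , _ , x-unique ← lonely {i} {l} (λ { refl → v∉Mi v∈Ml }) =
      contradiction (trans (sym (x-unique (proj₁ v) (only v v∉Mi))) (x-unique (proj₁ w) (only w w∉Mi))) v≉w

  outside : Fin n → Vertex → Bool
  outside i v = not (does (proj₁ v ∈M? i))

  outside-cong : ∀ i {v w} → v ≈ⱽ w → outside i v ≡ outside i w
  outside-cong i {v} {w} v≈w = cong not
    (does-⇔ (mk⇔ (M-ideal.resp i v≈w) (M-ideal.resp i (sym v≈w))) (proj₁ v ∈M? i) (proj₁ w ∈M? i))

  ∈M⇒outside : ∀ {i} {v : Vertex} → proj₁ v ∈ M i → outside i v ≡ false
  ∈M⇒outside {i} {v} v∈Mi = cong not (dec-true (proj₁ v ∈M? i) v∈Mi)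

  ∉M⇒outside : ∀ {i} {v : Vertex} → proj₁ v ∉ M i → outside i v ≡ true
  ∉M⇒outside {i} {v} v∉Mi = cong not (dec-false (proj₁ v ∈M? i) v∉Mi)

  outside⇒∈M : ∀ {i} {v : Vertex} → outside i v ≡ false → proj₁ v ∈ M i
  outside⇒∈M {i} {v} eq with proj₁ v ∈M? i
  ... | yes v∈Mi = v∈Mi

  Representable : ℕ → Set _
  Representable d = IsIntersectionOfSome IsIntervalGraph Γ d × IsIntersectionOfSome IsThresholdGraph Γ d

  representable-n : Representable n
  representable-n = represent (code ∘ proj₁) code-cong code-injective {G = Γ}
    -- The constant second entry means that no graph is modified for a lonely prime.
    (λ i v → outside i v , false) (λ i {v} {w} v≈w → cong (_, false) (outside-cong i {v} {w} v≈w))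
    λ v w v≉w → mk⇔
      (λ vw i → Compatible-intro
        (Sum.map (∈M⇒outside {i} {v}) (∈M⇒outside {i} {w}) (⇒ (Adj⇔ {v} {w} v≉w) vw i)) (inj₁ refl))
      (λ compat → ⇐ (Adj⇔ {v} {w} v≉w) λ i →
        Sum.map (outside⇒∈M {i} {v}) (outside⇒∈M {i} {w}) (Compatible⇒false (compat i)))

  -- The non-edges are pairs of distinct vertices with equal support {ι i}; vertices from different
  -- pairs are adjacent. The map ι allows the bound to be applied to a subset of the indices.
  nonlonely-bound : ∀ {k} (ι : Fin k → Fin n) → (∀ {i j} → ι i ≡ ι j → i ≡ j) →
    (∀ i → ¬ Lonely M (ι i)) → (∀ i → ∃ λ l → l ≢ i) →
    (∀ {d} → IsIntersectionOfSome IsIntervalGraph Γ d → k ≤ d) ×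
    (∀ {d} → IsIntersectionOfSome IsThresholdGraph Γ d → k ≤ d)
  nonlonely-bound {k} ι ι-injective ¬lonely other =
    exclusive-non-edges-bound {G = Γ} x y x≉y ¬xy (λ {H} H-interval ⊆H {i} {k} i≢k ¬xyᵢ ¬xyₖ →
      interval-no-C₄ {H = H} H-interval (x≉y i) (x≉y k) ¬xyᵢ ¬xyₖ
        (⊆H (adj {x i} {y k} i≢k (x-only i) (y-only k))) (⊆H (adj {x k} {y i} (i≢k ∘ ≡.sym) (x-only k) (y-only i)))
        (⊆H (adj {x i} {x k} i≢k (x-only i) (x-only k))) (⊆H (adj {y i} {y k} i≢k (y-only i) (y-only k)))) ,
    exclusive-non-edges-bound {G = Γ} x y x≉y ¬xy (λ {H} H-threshold ⊆H {i} {k} i≢k ¬xyᵢ ¬xyₖ →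
      threshold-no-alternating-4-cycle {H = H} H-threshold (x≉y i) (x≉y k) ¬xyᵢ ¬xyₖ
        (⊆H (adj {x i} {y k} i≢k (x-only i) (y-only k))) (⊆H (adj {x k} {y i} (i≢k ∘ ≡.sym) (x-only k) (y-only i))))
    where
    only-vertex : ∀ {i z} → OnlyOutside M i z → Vertex
    only-vertex {i} {z} (z∈M , z∉Mi) with l , l≢i ← other i = vertex z z∉Mi (z∈M l l≢i)

    x y : Fin k → Vertex
    x i = only-vertex (proj₂ (∃-OnlyOutside (ι i)))
    other-y : ∀ i → ∃ λ y → OnlyOutside M (ι i) y × ¬ (proj₁ (∃-OnlyOutside (ι i)) ≈ y)
    other-y i = ¬Lonely⇒∃-other (¬lonely i) (proj₂ (∃-OnlyOutside (ι i)))
    y i = only-vertex (proj₁ (proj₂ (other-y i)))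

    x-only : ∀ i → OnlyOutside M (ι i) (proj₁ (x i))
    x-only i = proj₂ (∃-OnlyOutside (ι i))
    y-only : ∀ i → OnlyOutside M (ι i) (proj₁ (y i))
    y-only i = proj₁ (proj₂ (other-y i))

    x≉y : ∀ i → ¬ (x i ≈ⱽ y i)
    x≉y i = proj₂ (proj₂ (other-y i))

    ¬xy : ∀ i → ¬ Adj (x i) (y i)
    ¬xy i = ¬Adj-intro {x i} {y i} (ι i) (proj₂ (x-only i)) (proj₂ (y-only i))

    adj : ∀ {v w : Vertex} {i k} → i ≢ k → OnlyOutside M (ι i) (proj₁ v) → OnlyOutside M (ι k) (proj₁ w) → Adj v w
    adj {v} {w} i≢k = OnlyOutside-Adj {v} {w} (i≢k ∘ ι-injective)

-- The bounds n - 1, where n = suc m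

module ManyPrimes {c ℓ p} (R : CommutativeRing c ℓ)
  (finite : IsFinite (CommutativeRing.setoid R)) (reduced : RingDefs.IsReduced R)
  {m : ℕ} (M : Fin (suc m) → Pred (CommutativeRing.Carrier R) p)
  (all-M : RingDefs.AreTheMinimalPrimeIdeals R M) where

  open CommutativeRing R hiding (zero; refl)
  open RingDefs R
  open FiniteReducedRing R finite reduced
  open MinimalPrimes M all-M
  open ZeroDivisorGraph R finite reduced M all-M
  open Graph Γ using (Adj; irrefl; symm)
  open Setoid Γ-vertices using () renaming (Carrier to Vertex; _≈_ to _≈ⱽ_)

  -- The graphs belong to the indices other than j. If v and w both lie outside M j, compatibility
  -- in all of them forces both into every other prime, so both equal the one element there.
  lonely⇒representable : ∃ (Lonely M) → Representable m
  lonely⇒representable (j , x , _ , x-unique) = represent (code ∘ proj₁) code-cong code-injective {G = Γ}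
    (λ i v → outside (punchIn j i) v , outside j v)
    (λ i {v} {w} v≈w → cong₂ _,_ (outside-cong (punchIn j i) {v} {w} v≈w) (outside-cong j {v} {w} v≈w))
    λ v w v≉w → mk⇔
      (λ vw i → Compatible-intro
        (Sum.map (∈M⇒outside {punchIn j i} {v}) (∈M⇒outside {punchIn j i} {w})
          (⇒ (Adj⇔ {v} {w} v≉w) vw (punchIn j i)))
        (Sum.map (∈M⇒outside {j} {v}) (∈M⇒outside {j} {w}) (⇒ (Adj⇔ {v} {w} v≉w) vw j)))
      (λ compat → ⇐ (Adj⇔ {v} {w} v≉w) (∈M v w v≉w compat))
    where
    ∈M : ∀ v w → ¬ (v ≈ⱽ w) →
      (∀ i → Compatible (outside (punchIn j i) v , outside j v) (outside (punchIn j i) w , outside j w)) →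
      ∀ k → proj₁ v ∈ M k ⊎ proj₁ w ∈ M k
    ∈M v w v≉w compat k with j ≟ k
    ... | no j≢k = subst (λ k → proj₁ v ∈ M k ⊎ proj₁ w ∈ M k) (Fin.punchIn-punchOut j≢k)
      (Sum.map (outside⇒∈M {punchIn j i} {v}) (outside⇒∈M {punchIn j i} {w}) (Compatible⇒false (compat i)))
      where
      i = punchOut j≢k
    ... | yes refl with toSum (proj₁ v ∈M? j) | toSum (proj₁ w ∈M? j)
    ...   | inj₁ v∈Mj | _         = inj₁ v∈Mj
    ...   | inj₂ _    | inj₁ w∈Mj = inj₂ w∈Mj
    ...   | inj₂ v∉Mj | inj₂ w∉Mj = contradiction
      (trans (sym (x-unique (proj₁ v) (v-only , v∉Mj))) (x-unique (proj₁ w) (w-only , w∉Mj))) v≉w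
      where
      both-inside : ∀ i → outside (punchIn j i) v ≡ false × outside (punchIn j i) w ≡ false
      both-inside i = Compatible-true⇒false (subst₂
        (λ q q′ → Compatible (outside (punchIn j i) v , q) (outside (punchIn j i) w , q′))
        (∉M⇒outside {j} {v} v∉Mj) (∉M⇒outside {j} {w} w∉Mj) (compat i))
      v-only : ∀ k → k ≢ j → proj₁ v ∈ M k
      v-only k k≢j = subst (λ k → proj₁ v ∈ M k) (Fin.punchIn-punchOut (k≢j ∘ ≡.sym))
        (outside⇒∈M {_} {v} (proj₁ (both-inside (punchOut (k≢j ∘ ≡.sym)))))
      w-only : ∀ k → k ≢ j → proj₁ w ∈ M k
      w-only k k≢j = subst (λ k → proj₁ w ∈ M k) (Fin.punchIn-punchOut (k≢j ∘ ≡.sym))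
        (outside⇒∈M {_} {w} (proj₂ (both-inside (punchOut (k≢j ∘ ≡.sym)))))

  module _ (2≤m : 2 ≤ m) where

    u : Fin (suc m) → Carrier
    u i = proj₁ (∃-OnlyOutside i)

    u∈M : ∀ {i l} → l ≢ i → u i ∈ M l
    u∈M {i} l≢i = proj₁ (proj₂ (∃-OnlyOutside i)) _ l≢i

    u∉M : ∀ i → u i ∉ M i
    u∉M i = proj₂ (proj₂ (∃-OnlyOutside i))

    s : Fin (suc m) → Vertex
    s i with l , l≢i , _ ← third 2≤m i i = vertex (u i) (u∉M i) (u∈M l≢i)

    -- An element with support {i , k}. On the diagonal the sum u i + u i could vanish, as in
    -- characteristic 2, so `u i` is taken instead.
    pair : Fin (suc m) → Fin (suc m) → Carrier
    pair i k with i ≟ k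
    ... | yes _ = u i
    ... | no _  = u i + u k

    pair∈M : ∀ {i k l} → l ≢ i → l ≢ k → pair i k ∈ M l
    pair∈M {i} {k} {l} l≢i l≢k with i ≟ k
    ... | yes _ = u∈M l≢i
    ... | no _  = M-ideal.+-closed l (u∈M l≢i) (u∈M l≢k)

    pair∉Mˡ : ∀ i k → pair i k ∉ M i
    pair∉Mˡ i k with i ≟ k
    ... | yes _  = u∉M i
    ... | no i≢k = λ ∈Mi → u∉M i (+-cancelʳ-∈ (M-prime i) ∈Mi (u∈M i≢k))

    pair-comm : ∀ i k → pair i k ≈ pair k i
    pair-comm i k with i ≟ k | k ≟ i
    ... | yes refl | yes _   = CommutativeRing.refl R
    ... | yes refl | no k≢i  = contradiction refl k≢i
    ... | no i≢k   | yes k≡i = contradiction (≡.sym k≡i) i≢k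
    ... | no _     | no _    = +-comm (u i) (u k)

    pair∉Mʳ : ∀ i k → pair i k ∉ M k
    pair∉Mʳ i k = pair∉Mˡ k i ∘ M-ideal.resp k (pair-comm i k)

    -- The third index makes the support {i , k} proper; this is where n ≥ 3 enters.
    e : Fin (suc m) → Fin (suc m) → Vertex
    e i k with l , l≢i , l≢k ← third 2≤m i k = vertex (pair i k) (pair∉Mˡ i k) (pair∈M l≢i l≢k)

    s≉e : ∀ {i k} → i ≢ k → ¬ (s i ≈ⱽ e i k)
    s≉e {i} {k} i≢k s≈e = pair∉Mʳ i k (M-ideal.resp k s≈e (u∈M (i≢k ∘ ≡.sym)))

    ¬se : ∀ i k → ¬ Adj (s i) (e i k)
    ¬se i k = ¬Adj-intro {s i} {e i k} i (u∉M i) (pair∉Mˡ i k)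

    ss : ∀ {i k} → i ≢ k → Adj (s i) (s k)
    ss {i} {k} i≢k = OnlyOutside-Adj {s i} {s k} i≢k (proj₂ (∃-OnlyOutside i)) (proj₂ (∃-OnlyOutside k))

    se : ∀ {i k j} → j ≢ i → j ≢ k → Adj (s j) (e i k)
    se {i} {k} {j} j≢i j≢k = Adj-intro {s j} {e i k} j (u∉M j) ∈M
      where
      ∈M : ∀ l → u j ∈ M l ⊎ pair i k ∈ M l
      ∈M l with l ≟ j
      ... | yes refl = inj₂ (pair∈M j≢i j≢k)
      ... | no l≢j   = inj₁ (u∈M l≢j)

    ee : ∀ {i k j l} → ¬ SharesEnd i k j l → Adj (e i k) (e j l)
    ee {i} {k} {j} {l} disjoint = Adj-intro {e i k} {e j l} i (pair∉Mˡ i k) ∈M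
      where
      ∈M : ∀ h → pair i k ∈ M h ⊎ pair j l ∈ M h
      ∈M h with h ≟ i | h ≟ k
      ... | yes refl | _        = inj₂ (pair∈M (disjoint ∘ inj₁) (disjoint ∘ inj₂ ∘ inj₁))
      ... | no _     | yes refl = inj₂ (pair∈M (disjoint ∘ inj₂ ∘ inj₂ ∘ inj₁) (disjoint ∘ inj₂ ∘ inj₂ ∘ inj₂))
      ... | no h≢i   | no h≢k   = inj₁ (pair∈M h≢i h≢k)

    m≤boxicity : ∀ {d} → IsIntersectionOfSome IsIntervalGraph Γ d → m ≤ d
    m≤boxicity = boxicity-bound {G = Γ} 2≤m s e s≉e ¬se (λ {i} {k} → ss {i} {k})
      (λ {i} {k} {j} → se {i} {k} {j}) (λ {i} {k} {j} {l} → ee {i} {k} {j} {l}) pair-comm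

    -- The vertices `e (suc i) zero` share the index 0, hence are pairwise non-adjacent and span no
    -- 4-cycle with the `s (suc i)`. The two edges of an alternating 4-cycle are present
    -- nevertheless.
    m≤threshold-dimension : ∀ {d} → IsIntersectionOfSome IsThresholdGraph Γ d → m ≤ d
    m≤threshold-dimension = exclusive-non-edges-bound {G = Γ} (s ∘ suc) (λ i → e (suc i) zero)
      (λ i → s≉e {suc i} {zero} λ ()) (λ i → ¬se (suc i) zero) λ {H} H-threshold ⊆H {i} {k} i≢k ¬seᵢ ¬seₖ →
        threshold-no-alternating-4-cycle {H = H} H-threshold
          {s (suc i)} {e (suc i) zero} {s (suc k)} {e (suc k) zero} (s≉e {suc i} {zero} λ ()) (s≉e {suc k} {zero} λ ()) ¬seᵢ ¬seₖ
          (⊆H (se {suc k} {zero} {suc i} (i≢k ∘ Fin.suc-injective) λ ()))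
          (⊆H (se {suc i} {zero} {suc k} (i≢k ∘ ≡.sym ∘ Fin.suc-injective) λ ()))

-- The cases n = 1, n = 2 and n ≥ 3

theorem8 : ∀ {c ℓ p} (R : CommutativeRing c ℓ) →
    let open CommutativeRing R
        open RingDefs R in
    IsFinite setoid →
    IsReduced →
    ¬ (1# ≈ 0#) →
    (n : ℕ) (M : Fin n → Pred Carrier p) →
    AreTheMinimalPrimeIdeals M →
    let BothEqual : ℕ → Set (c ⊔ Level.suc ℓ)
        BothEqual = λ d → IsBoxicity Γ d × IsThresholdDimension Γ d in
    (n ≡ 1 → BothEqual 0)
    ×
    (n ≡ 2 →
      ((∀ i → Lonely M i) → BothEqual 0)
      × (∃! _≡_ (λ i → Lonely M i) → BothEqual 1)
      × ((∀ i → ¬ Lonely M i) → BothEqual 2))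
    ×
    (3 ≤ n →
      (∃ (λ i → Lonely M i) → BothEqual (n ∸ 1))
      × (¬ ∃ (λ i → Lonely M i) → BothEqual n))
theorem8 R finite reduced _ n M all-M =
  (λ { refl → complete⇒0 (few-primes-complete
    (λ { {zero} {zero} {zero} _ _ → refl }) (λ { {zero} {zero} 0≢0 → contradiction refl 0≢0 })) }) ,
  (λ { refl →
    (λ lonely → complete⇒0 (few-primes-complete 2-primes (λ {i} _ → lonely i))) ,
    (λ (j , j-lonely , j-unique) → both {1} (ManyPrimes.lonely⇒representable R finite reduced M all-M (j , j-lonely))
      -- The index other than j is not lonely by uniqueness, and it alone yields the bound 1.
      (nonlonely-bound (λ (_ : Fin 1) → punchIn j zero) (λ { {zero} {zero} _ → refl })
        (λ _ lonely → Fin.punchInᵢ≢i j zero (≡.sym (j-unique lonely))) other-index)) ,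
    (λ ¬lonely → both {2} representable-n (nonlonely-bound id id ¬lonely other-index)) }) ,
  -- The inner match exhibits n as 2 + k, the form that `other-index` expects.
  (λ { (s≤s 2≤m@(s≤s _)) →
    (λ lonely → both (ManyPrimes.lonely⇒representable R finite reduced M all-M lonely)
      (ManyPrimes.m≤boxicity R finite reduced M all-M 2≤m ,
       ManyPrimes.m≤threshold-dimension R finite reduced M all-M 2≤m)) ,
    (λ ¬lonely → both representable-n (nonlonely-bound id id (λ i lonely → ¬lonely (i , lonely)) other-index)) })
  where
  open RingDefs R
  open ZeroDivisorGraph R finite reduced M all-M

  other-index : ∀ {k} (i : Fin (2 ℕ.+ k)) → ∃ λ l → l ≢ i
  other-index i = punchIn i zero , Fin.punchInᵢ≢i i zero

  2-primes : ∀ {i k l : Fin 2} → k ≢ i → l ≢ i → k ≡ l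
  2-primes {i} {k} {l} k≢i l≢i = Fin.punchOut-injective (k≢i ∘ ≡.sym) (l≢i ∘ ≡.sym) (Fin1-prop _ _)
    where
    Fin1-prop : ∀ (x y : Fin 1) → x ≡ y
    Fin1-prop zero zero = refl

  both : ∀ {d} → Representable d →
    (∀ {d′} → IsIntersectionOfSome IsIntervalGraph Γ d′ → d ≤ d′) ×
    (∀ {d′} → IsIntersectionOfSome IsThresholdGraph Γ d′ → d ≤ d′) → BothEqual d
  both (interval , threshold) (box≥ , dim≥) = (interval , λ _ → box≥) , (threshold , λ _ → dim≥)
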